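{- Let $n\ge1$, let $\underline{k}$ be a right-justified composition of $n$, and let $w$ be a word of content $\underline{k}$. Then $\mathrm{tree}(w)$ is a valid slide tree (that is, $\mathrm{tree}(w)\in\mathrm{Slide}^\psi(\underline{k})$ and the edge labels given by its $\psi$ $\underline{k}$-slide labeling, read from the root outward, form the word $w$) if and only if $w$ avoids the patterns $2{ - }1{ - }2$ and $23{ - }\overline{2}{ - }1$.
   Context: **Compositions and words.** A composition of $n$ is an $n$-tuple $\underline{k}=(k_1,\dots,k_n)$ of nonnegative integers with sum $n$. It is right-justified if all zero entries occur before all nonzero entries. A word $w=w_1\cdots w_n$ has content $\underline{k}$ if each letter $i\in\{1,\dots,n\}$ occurs exactly $k_i$ times in $w$. The word $w$ avoids $2{ - }1{ - }2$ if there are no indices $p<q<r$ with $w_p=w_r>w_q$. It avoids $23{ - }\overline{2}{ - }1$ if whenever $p+1<q$ and $w_q<w_p<w_{p+1}$, there is $s$ with $p+1<s<q$ and $w_s=w_p$. **Trees.** Labels are ordered $a<b<c<1<\dots<n$. A stable tree is a finite tree whose non-leaf vertices all have degree at least 3 and whose leaves are bijectively labeled by $\{a,b,c,1,\dots,n\}$, up to label-preserving isomorphism. An internal edge joins two non-leaf vertices. **Slide labeling.** The $\psi$ $\underline{k}$-slide labeling of a stable tree $T$ is the result of the following procedure, if it never fails. For $\ell=n,n-1,\dots,1$ in this order, do the following $k_\ell$ times: let $T'$ be $T$ with all already labeled internal edges contracted; let $e$ be the first internal edge of $T'$ on the path from leaf $\ell$ to leaf $a$ (fail if none exists); let $v_\ell$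 be the vertex of $T'$ adjacent to $\ell$ and $v$ the other endpoint of $e$; let $m_\ell$ be the smallest leaf label among branches at $v_\ell$ in $T'$ not containing $a$ or $\ell$, and $m_a$ the smallest leaf label among branches at $v$ not containing $a$ or $\ell$; if $m_\ell\ge m_a$, label $e$ with $\ell$, otherwise fail. $\mathrm{Slide}^\psi(\underline{k})$ is the set of stable trees admitting a $\psi$ $\underline{k}$-slide labeling (by a known theorem this agrees with the definition by iterated slides). Such trees are trivalent with $n$ internal edges, all labeled, and $a,b$ have a common neighbor (the root). A caterpillar tree is a trivalent tree whose internal edges form a path; its edge word is read along the path starting at the root. **The tree $\mathrm{tree}(w)$.** Given a word $w$ of content $\underline{k}$: 1. Take a path with $n$ edges (the internal edges) and attach leaf edges so that it becomes trivalent. 2. The left end is the root; label its two leaves $a$ and $b$. 3. Label the internal edges from left to right with the letters of $w$. 4. For consecutive internal edges labeled $x$ (left) and $y$ (right), the leaf between them is a descent leaf if $x>y$ and a nondescent leaf if $x\le y$. Of the two leaves at the right end, one is declared a descent leaf and the other a nondescent leaf (the rightmost one). 5. Label each descent leaf with the label of the internal edge immediately to its left. 6. List the remaining unused labels among $c,1,\dots,n$. 7. From left to right, label each nondescent leaf by the smallest remaining unused label, unless that label equals the label of the internal edge immediately to the right of that leaf, in which case use the second smallest unused label. 8. Forget the edge labels. If the resulting leaf labels are not all distinct, the tree is not a slide tree. -}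

module Defs where

open import Data.Bool using (true; false; if_then_else_)
open import Data.Fin as Fin using (Fin; zero; suc; toℕ; inject₁; fromℕ; pinch)
open import Data.Fin.Properties using (_≟_; _<?_)
open import Data.List using (List; []; _∷_; _++_; map; filter; concatMap; replicate; reverse; allFin; length; head)
open import Data.List.Membership.Propositional using (_∈_; _∉_)
open import Data.List.Relation.Binary.Pointwise using (Pointwise)
open import Data.List.Relation.Unary.All using (All)
open import Data.Maybe using (Maybe; just; nothing)
open import Data.Nat using (ℕ; suc; _≤_)
open import Data.Product using (Σ; ∃; ∃!; ∃-syntax; ∃₂; _×_; _,_; proj₁; proj₂)
open import Data.Refinement using (Refinement-syntax; value)
open import Data.Sum using (_⊎_; inj₁; inj₂)
open import Data.Vec as Vec using (Vec; []; _∷_; lookup; toList)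
open import Function using (_∘_)
open import Function.Bundles using (Inverse)
open import Level using (0ℓ)
open import Relation.Binary.Bundles using (Setoid)
import Relation.Binary.Construct.Closure.Equivalence as Equivalence
open import Relation.Binary.PropositionalEquality using (_≡_; _≢_; setoid)
open import Relation.Nullary using (¬_; does; ¬?)

import Data.List.Membership.DecPropositional as DecMembership
import Data.List.Relation.Unary.Unique.Propositional as Propositional
import Data.List.Relation.Unary.Unique.Setoid as Setoidal

------------------------------------------------------------------------
-- Compositions and words.  The letter i ∈ {1,…,n} is the element of Fin n
-- with toℕ equal to i − 1; positions are indexed in the same way.

IsComposition : ∀ {n} → Vec ℕ n → Set
IsComposition {n} k = Vec.sum k ≡ n

RightJustified : ∀ {n} → Vec ℕ n → Set
RightJustified k = ∀ i j → lookup k i ≡ 0 → lookup k j ≢ 0 → i Fin.< j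

Word : ℕ → Set
Word n = Vec (Fin n) n

HasContent : ∀ {n} → Word n → Vec ℕ n → Set
HasContent w k = ∀ i → Vec.count (i ≟_) w ≡ lookup k i

Avoids-2-1-2 : ∀ {n} → Word n → Set
Avoids-2-1-2 w = ∀ p q r → p Fin.< q → q Fin.< r →
  ¬ (lookup w p ≡ lookup w r × lookup w q Fin.< lookup w r)

Avoids-23-2̅-1 : ∀ {n} → Word n → Set
Avoids-23-2̅-1 w = ∀ p p⁺ q → toℕ p⁺ ≡ suc (toℕ p) → p⁺ Fin.< q →
  lookup w q Fin.< lookup w p → lookup w p Fin.< lookup w p⁺ →
  ∃[ s ] (p⁺ Fin.< s × s Fin.< q × lookup w s ≡ lookup w p)

------------------------------------------------------------------------
-- Leaf labels a < b < c < 1 < … < n, ordered as elements of Fin (3 + n).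

Label : ℕ → Set
Label n = Fin (suc (suc (suc n)))

pattern a = zero
pattern b = suc zero
pattern c = suc (suc zero)
pattern num i = suc (suc (suc i))

------------------------------------------------------------------------
-- Graphs.  The vertices form a setoid, so that edges can be contracted
-- by coarsening the equality of vertices.

record Graph : Set₁ where
  field
    vertices : Setoid 0ℓ 0ℓ
    Edge     : Set

  open Setoid vertices public using (_≈_; _≉_) renaming (Carrier to Vertex)

  field
    source target : Edge → Vertex

  Joins : Edge → Vertex → Vertex → Set
  Joins e u v = (source e ≈ u × target e ≈ v) ⊎ (source e ≈ v × target e ≈ u)

  Incident : Vertex → Edge → Set
  Incident v e = source e ≈ v ⊎ target e ≈ v

  Adjacent : Vertex → Vertex → Set
  Adjacent u v = ∃[ e ] Joins e u v

  -- On loopless graphs, the next two count the degree.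
  IsLeaf : Vertex → Set
  IsLeaf v = ∃! _≡_ (Incident v)

  DegreeAtLeast : ℕ → Vertex → Set
  DegreeAtLeast d v =
    ∃[ es ] (d ≤ length es × Propositional.Unique es × All (Incident v) es)

  IsInternal : Edge → Set
  IsInternal e = ¬ IsLeaf (source e) × ¬ IsLeaf (target e)

module _ (G : Graph) where
  open Graph G

  data Walk : Vertex → Vertex → Set where
    stop : ∀ {u v} → u ≈ v → Walk u v
    step : ∀ {u v w} (e : Edge) → Joins e u v → Walk v w → Walk u w

module _ {G : Graph} where
  open Graph G

  edges : ∀ {u v} → Walk G u v → List Edge
  edges (stop _)     = []
  edges (step e _ p) = e ∷ edges p

  visited : ∀ {u v} → Walk G u v → List Vertex
  visited (stop {u} _)     = u ∷ []
  visited (step {u} _ _ p) = u ∷ visited p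

  IsPath : ∀ {u v} → Walk G u v → Set
  IsPath p = Setoidal.Unique vertices (visited p)

module _ (G : Graph) where
  open Graph G

  -- x and y lie in the same branch at v, i.e. in the same connected
  -- component of G with v removed.
  SameBranch : Vertex → Vertex → Vertex → Set
  SameBranch v x y = Σ (Walk G x y) λ p → All (_≉ v) (visited p)

  record IsTree : Set where
    field
      finite    : ∃[ m ] Inverse (setoid (Fin m)) vertices
      connected : ∀ u v → Walk G u v
      -- No circuits; this also excludes loops and parallel edges.
      acyclic   : ∀ {v} (p : Walk G v v) → Propositional.Unique (edges p) → edges p ≡ []

  contract : List Edge → Graph
  contract S = record
    { vertices = Equivalence.setoid λ u v → u ≈ v ⊎ (∃[ e ] (e ∈ S × Joins e u v))
    ; Edge     = [ e ∈ Edge ∣ e ∉ S ]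
    ; source   = source ∘ value
    ; target   = target ∘ value
    }

------------------------------------------------------------------------
-- Stable trees.  Isomorphic trees are not identified; all notions below
-- are invariant under label-preserving isomorphism.

record LabelledGraph (n : ℕ) : Set₁ where
  field
    graph : Graph
    label : Graph.Vertex graph → Maybe (Label n)

module _ {n : ℕ} (T : LabelledGraph n) where
  open LabelledGraph T
  open Graph graph

  record IsStableTree : Set where
    field
      isTree          : IsTree graph
      stable          : ∀ v → ¬ IsLeaf v → DegreeAtLeast 3 v
      label-cong      : ∀ {u v} → u ≈ v → label u ≡ label v
      leaf⇒labelled   : ∀ v → IsLeaf v → ∃[ x ] label v ≡ just x
      labelled⇒leaf   : ∀ {v x} → label v ≡ just x → IsLeaf v
      label-bijective : ∀ x → ∃! _≈_ λ v → label v ≡ just x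

    leaf : Label n → Vertex
    leaf x = proj₁ (label-bijective x)

------------------------------------------------------------------------
-- Slide labelings

IsFirst : {A : Set} → (A → Set) → A → List A → Set
IsFirst P x xs = ∃₂ λ pre post → xs ≡ pre ++ x ∷ post × All (¬_ ∘ P) pre × P x

IsSmallest : ∀ {n} → (Label n → Set) → Label n → Set
IsSmallest P m = P m × (∀ x → P x → m Fin.≤ x)

module _ {n : ℕ} {T : LabelledGraph n} (stableTree : IsStableTree T) where
  open LabelledGraph T
  open Graph graph using (Vertex; Edge)
  open IsStableTree stableTree

  -- The letter ℓ may be given to the edge e when the edges in S are
  -- those already labeled.
  record SlideStep (ℓ : Fin n) (S : List Edge) (e : Graph.Edge (contract graph S)) : Set where
    T′ : Graph
    T′ = contract graph S

    field
      path         : Walk T′ (leaf (num ℓ)) (leaf a)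
      isPath       : IsPath path
      first        : IsFirst (Graph.IsInternal T′) e (edges path)
      vℓ v         : Vertex
      vℓ-adjacent  : Graph.Adjacent T′ (leaf (num ℓ)) vℓ
      e-joins      : Graph.Joins T′ e vℓ v

    -- x labels a leaf in a branch at u containing neither a nor ℓ.
    InOtherBranch : Vertex → Label n → Set
    InOtherBranch u x = ¬ SameBranch T′ u (leaf x) (leaf a)
                      × ¬ SameBranch T′ u (leaf x) (leaf (num ℓ))

    field
      mℓ ma        : Label n
      mℓ-smallest  : IsSmallest (InOtherBranch vℓ) mℓ
      ma-smallest  : IsSmallest (InOtherBranch v) ma
      ma≤mℓ        : ma Fin.≤ mℓ

  EdgeLabeling : Set
  EdgeLabeling = List (Edge × Fin n)

  -- Performing the steps for the given letters in turn, starting from the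
  -- first edge labeling, succeeds and results in the second.
  data Slides : List (Fin n) → EdgeLabeling → EdgeLabeling → Set where
    done : ∀ {λs} → Slides [] λs λs
    next : ∀ {ℓ ℓs λs λs′} (e : Graph.Edge (contract graph (map proj₁ λs))) →
           SlideStep ℓ (map proj₁ λs) e →
           Slides ℓs ((value e , ℓ) ∷ λs) λs′ →
           Slides (ℓ ∷ ℓs) λs λs′

  -- The letters n, n−1, …, 1 in this order, each ℓ repeated k_ℓ times.
  schedule : Vec ℕ n → List (Fin n)
  schedule k = concatMap (λ ℓ → replicate (lookup k ℓ) ℓ) (reverse (allFin n))

  IsSlideLabeling : Vec ℕ n → EdgeLabeling → Set
  IsSlideLabeling k λs = Slides (schedule k) [] λs

  -- The internal edges form a path which starts at the root, the common
  -- neighbor of a and b, and along which their labels spell w.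
  record IsEdgeWord (λs : EdgeLabeling) (w : Word n) : Set where
    field
      root end : Vertex
      root-a   : Graph.Adjacent graph root (leaf a)
      root-b   : Graph.Adjacent graph root (leaf b)
      spine    : Walk graph root end
      isPath   : IsPath spine
      internal : All (Graph.IsInternal graph) (edges spine)
      complete : ∀ e → Graph.IsInternal graph e → e ∈ edges spine
      reads    : Pointwise (λ e x → (e , x) ∈ λs) (edges spine) (toList w)

_∈Slide_ : ∀ {n} → LabelledGraph n → Vec ℕ n → Set
T ∈Slide k = Σ (IsStableTree T) λ st → ∃ (IsSlideLabeling st k)

IsValidSlideTree : ∀ {n} → LabelledGraph n → Vec ℕ n → Word n → Set
IsValidSlideTree T k w =
  Σ (T ∈Slide k) λ (st , λs , _) → IsEdgeWord st λs w

------------------------------------------------------------------------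
-- The tree of a word

module _ {n : ℕ} where
  open DecMembership (_≟_ {suc (suc (suc n))}) using (_∈?_)

  -- Labels of the descent leaves, including the one at the right end.
  descentLabels : List (Fin n) → List (Label n)
  descentLabels []           = []
  descentLabels (x ∷ [])     = num x ∷ []
  descentLabels (x ∷ y ∷ ws) =
    if does (y <? x) then num x ∷ descentLabels (y ∷ ws) else descentLabels (y ∷ ws)

  unusedLabels : List (Fin n) → List (Label n)
  unusedLabels ws =
    filter (λ x → ¬? (x ∈? descentLabels ws)) (c ∷ map (λ i → num i) (allFin n))

  -- From an increasing list of unused labels, the label of a nondescent
  -- leaf with the edge labeled y to its right, and the labels left over.
  -- There are always enough labels, so nothing never occurs in tree below.
  choose : Fin n → List (Label n) → Maybe (Label n) × List (Label n)
  choose y []       = nothing , []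
  choose y (u ∷ us) with does (u ≟ num y)
  choose y (u ∷ us)      | false = just u , us
  choose y (u ∷ [])      | true  = nothing , u ∷ []
  choose y (u ∷ u′ ∷ us) | true  = just u′ , u ∷ us

  -- Labels, from left to right, of the leaves to the right of the first
  -- edge of a word; us lists the unused labels.  The final two leaves
  -- are the descent leaf and the nondescent leaf at the right end.
  fill : ∀ {m} → List (Label n) → Vec (Fin n) m → Vec (Maybe (Label n)) (suc m)
  fill us []           = head us ∷ []
  fill us (x ∷ [])     = just (num x) ∷ fill us []
  fill us (x ∷ y ∷ ws) =
    if does (y <? x)
    then just (num x) ∷ fill us (y ∷ ws)
    else proj₁ (choose y us) ∷ fill (proj₂ (choose y us)) (y ∷ ws)

  leafLabels : Word n → Vec (Maybe (Label n)) (suc (suc (suc n)))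
  leafLabels w = just a ∷ just b ∷ fill (unusedLabels (toList w)) w

-- Leaf positions 0,…,n+2 run from left to right.  The non-leaf vertices
-- 0,…,n of the path each carry one leaf, except that 0 carries the two
-- leftmost and n the two rightmost.
attach : ∀ {n} → Fin (suc (suc (suc n))) → Fin (suc n)
attach {n} = pinch (fromℕ n) ∘ pinch zero

caterpillar : ℕ → Graph
caterpillar n = record
  { vertices = setoid (Fin (suc n) ⊎ Fin (suc (suc (suc n))))
  ; Edge     = Fin n ⊎ Fin (suc (suc (suc n)))
  ; source   = λ { (inj₁ i) → inj₁ (inject₁ i) ; (inj₂ p) → inj₁ (attach p) }
  ; target   = λ { (inj₁ i) → inj₁ (suc i)     ; (inj₂ p) → inj₂ p }
  }

tree : ∀ {n} → Word n → LabelledGraph n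
tree {n} w = record
  { graph = caterpillar n
  ; label = λ { (inj₁ _) → nothing ; (inj₂ p) → lookup (leafLabels w) p }
  }

{-# OPTIONS --safe #-}
module Submission where

-- Number the internal edges from the root outward, so that edge i carries
-- the letter w_i, and let the depth of a leaf be the number of internal
-- edges between it and the root.  A step for ℓ labels the largest
-- unlabeled edge i among those between leaf ℓ and the root, and it
-- succeeds when the smallest label at the near end of i (after
-- contraction, apart from a) is at most the smallest label beyond i,
-- apart from ℓ.  When ℓ comes up, the labeled edges carry letters ≥ ℓ.
-- Hence the labeling can spell w only if, for each i,
--
--   (A) edge i is nearer to the root than leaf w_i, and all letters
--       between edge i and leaf w_i are at least w_i.
--
-- If (A) holds, then w avoids 2-1-2: leaf w_r lies beyond the last of the
-- equal letters (after⇒no212).  An occurrence of the other pattern yields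
-- i < q with w_i > w_q such that w_i is not the label of a descent leaf
-- (after⇒no23).  By (A) its label sits in a gap before q.  The labels left
-- after that gap outnumber the nondescents still to come, so one of them,
-- v, is no letter of the remaining word (missing-label, next-label).  It
-- exceeds w_i, hence occurs in w, as the content is right-justified; so it
-- occurs before the gap, exceeds w_q, and is not the label of a descent
-- leaf, while its own leaf lies further out.  Repeating the argument with
-- v never ends, which is absurd (no-late-label).
--
-- Conversely, let w avoid both patterns.  The same counting argument at
-- every nondescent yields an unused label that is no letter of the
-- remaining word.  Such a label is below all remaining letters, by right
-- justification if it does not occur in w and by the avoidance of 23-2̅-1
-- if it occurs only earlier (after-last).  Thus the smallest unused label
-- is below all remaining letters (head-small), so it is the one chosen and
-- never has to be skipped, and a nondescent leaf has a smaller label than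
-- every leaf to its right (nondescent-increases).  This gives (A) (own-label-after).  It also
-- gives the inequality in each step (block-leaf): the near end of edge i
-- either touches the root, and then carries b, or its leftmost leaf is a
-- nondescent leaf.
--
-- On the side of the trees, the main tool is that every edge e of a tree
-- is a bridge: the vertices have a 2-coloring constant along all edges
-- except e.  Such a coloring survives contraction of other edges, and it
-- shows that circuits do not exist, which vertices become equal, and which
-- vertices a walk must visit (Bridge, crossing, contract-bridge).

open import Defs
open import Data.Nat using (ℕ; _≥_)
open import Data.Product using (_×_)
open import Data.Vec using (Vec)
open import Function.Bundles using (_⇔_)

open import Data.Bool using (Bool; true; false; if_then_else_)
open import Data.Empty using (⊥-elim-irr)
open import Data.Fin as Fin using (Fin; zero; suc; toℕ; inject₁; fromℕ; fromℕ<; pinch)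
open import Data.Fin.Induction using (<-weakInduction; >-wellFounded)
open import Data.Fin.Properties as Finₚ
  using (_≟_; _<?_; toℕ-inject₁; toℕ-injective; toℕ<n; +↔⊎)
open import Data.Fin.Relation.Unary.Top using (view; ‵fromℕ; ‵inj₁)
open import Data.Irrelevant using ([_])
open import Data.List as List
  using (List; []; _∷_; _++_; map; length; filter; concatMap; replicate; reverse; allFin)
open import Data.List.Membership.Propositional using (_∈_; _∉_; find; lose)
open import Data.List.Membership.Propositional.Properties
  using ( ∈-++⁺ˡ; ∈-++⁺ʳ; ∈-++⁻; ∈-map⁺; ∈-map⁻; ∈-filter⁺; ∈-filter⁻; ∈-concatMap⁺
        ; ∈-allFin; ∈-lookup)
open import Data.List.Membership.Propositional.Properties.WithK using (unique∧set⇒bag)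
open import Data.List.Properties
  using ( length-map; length-++; length-tabulate; map-tabulate; map-concatMap; concatMap-cong
        ; unfold-reverse)
open import Data.List.Relation.Binary.BagAndSetEquality using (∼bag⇒↭)
open import Data.List.Relation.Binary.Permutation.Propositional
  using (_↭_; ↭-refl; ↭-sym; ↭-trans; ↭-prep; ↭-swap; ↭-reflexive; ↭⇒↭ₛ)
open import Data.List.Relation.Binary.Permutation.Propositional.Properties as Perm
  using (↭-length; ↭-reverse; filter-↭; shift; ∈-resp-↭; ++⁺ˡ)
import Data.List.Relation.Binary.Permutation.Setoid.Properties as SetoidPerm
open import Data.List.Relation.Binary.Pointwise using (Pointwise; []; _∷_)
open import Data.List.Relation.Unary.All as All using (All; []; _∷_)
import Data.List.Relation.Unary.All.Properties as Allₚ
open import Data.List.Relation.Unary.AllPairs as AllPairs using (AllPairs; []; _∷_)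
import Data.List.Relation.Unary.AllPairs.Properties as AllPairsₚ
open import Data.List.Relation.Unary.Any as Any using (Any; here; there)
import Data.List.Relation.Unary.Any.Properties as Anyₚ
open import Data.List.Relation.Unary.Unique.Propositional using (Unique)
import Data.List.Relation.Unary.Unique.Propositional.Properties as Uniqueₚ
open import Data.Maybe using (just)
open import Data.Maybe.Properties using (just-injective)
open import Data.Nat
  using (zero; suc; _+_; _∸_; _≤_; _<_; z≤n; s≤s; s<s; z<s; s≤s⁻¹; s<s⁻¹)
open import Data.Nat.Properties as ℕₚ hiding (_≟_; _<?_)
open import Data.Product using (∃; ∃₂; _,_; proj₁; proj₂; ∃-syntax)
open import Data.Refinement using (value; _,_)
open import Data.Sum as Sum using (_⊎_; inj₁; inj₂; [_,_]′)
open import Data.Sum.Properties using (inj₁-injective; inj₂-injective; ≡-dec)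
open import Data.Vec as Vec using ([]; _∷_; lookup; toList)
import Data.Vec.Membership.Propositional as Vec using (_∈_)
import Data.Vec.Membership.Propositional.Properties as Vec using (∈-lookup)
open import Data.Vec.Membership.Propositional.Properties using (∈-toList⁺; ∈-toList⁻)
import Data.Vec.Properties as Vecₚ
import Data.Vec.Relation.Unary.Any as Vec using (index)
import Data.Vec.Relation.Unary.Any.Properties as Vec using (lookup-index)
open import Function using (_∘_; id; case_of_)
open import Function.Bundles using (mk⇔)
open import Induction.WellFounded using (Acc; acc)
open import Relation.Binary.Bundles using (Setoid)
import Relation.Binary.Construct.Closure.Equivalence as Equivalence
open import Relation.Binary.Definitions using (tri<; tri≈; tri>)
open import Relation.Binary.PropositionalEquality
open import Relation.Nullary using (¬_; Dec; yes; no; does; contradiction; ¬?)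
open import Relation.Nullary.Decidable using (dec-true; dec-false; map′; _×-dec_)

import Data.List.Membership.DecPropositional as DecMembership

private variable
  n m : ℕ

------------------------------------------------------------------------
-- Avoidance for words of any length

num-mono : {x y : Fin n} → x Fin.< y → num x Fin.< num y
num-mono x<y = s<s (s<s (s<s x<y))

num-cancel : {x y : Fin n} → num x Fin.< num y → x Fin.< y
num-cancel p = s<s⁻¹ (s<s⁻¹ (s<s⁻¹ p))

-- The two avoidance conditions for words of arbitrary length m, needed to
-- pass to suffixes; for m = n they are those of the theorem by definition.
No212 : Vec (Fin n) m → Set
No212 ws = ∀ p q r → p Fin.< q → q Fin.< r →
  ¬ (lookup ws p ≡ lookup ws r × lookup ws q Fin.< lookup ws r)

No23-2̅-1 : Vec (Fin n) m → Set
No23-2̅-1 ws = ∀ p p⁺ q → toℕ p⁺ ≡ suc (toℕ p) → p⁺ Fin.< q →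
  lookup ws q Fin.< lookup ws p → lookup ws p Fin.< lookup ws p⁺ →
  ∃[ s ] (p⁺ Fin.< s × s Fin.< q × lookup ws s ≡ lookup ws p)

No212-tail : ∀ {x} {ws : Vec (Fin n) m} → No212 (x ∷ ws) → No212 ws
No212-tail avoid p q r p<q q<r = avoid (suc p) (suc q) (suc r) (s<s p<q) (s<s q<r)

No23-tail : ∀ {x} {ws : Vec (Fin n) m} → No23-2̅-1 (x ∷ ws) → No23-2̅-1 ws
No23-tail avoid p p⁺ q eq p<q lt₁ lt₂
  with avoid (suc p) (suc p⁺) (suc q) (cong suc eq) (s<s p<q) lt₁ lt₂
... | suc s , p<s , s<q , eq′ = s , s<s⁻¹ p<s , s<s⁻¹ s<q , eq′

------------------------------------------------------------------------
-- A pigeonhole principle for lists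

Unique-lookup : ∀ {A : Set} {xs : List A} → Unique xs → ∀ i j →
                List.lookup xs i ≡ List.lookup xs j → i ≡ j
Unique-lookup (_ ∷ _)   zero    zero    _  = refl
Unique-lookup (px ∷ _)  zero    (suc j) eq = contradiction eq (All.lookup px (∈-lookup j))
Unique-lookup (px ∷ _)  (suc i) zero    eq = contradiction (sym eq) (All.lookup px (∈-lookup i))
Unique-lookup (_ ∷ pxs) (suc i) (suc j) eq = cong suc (Unique-lookup pxs i j eq)

Unique-⊆-length : ∀ {A : Set} {xs ys : List A} → Unique xs → (∀ {x} → x ∈ xs → x ∈ ys) →
                  length xs ≤ length ys
Unique-⊆-length {xs = xs} {ys} xs! xs⊆ys with length ys ℕₚ.<? length xs
... | no ≮ = ≮⇒≥ ≮
... | yes lt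
  with Finₚ.pigeonhole lt (λ i → Any.index (xs⊆ys (∈-lookup i)))
... | i , j , i<j , eq = contradiction
        (Unique-lookup xs! i j
          (trans (Anyₚ.lookup-index (xs⊆ys (∈-lookup i)))
          (trans (cong (List.lookup ys) eq) (sym (Anyₚ.lookup-index (xs⊆ys (∈-lookup j)))))))
        (λ i≡j → Finₚ.<⇒≢ i<j i≡j)

escapes : ∀ {xs ys : List (Label n)} → Unique xs → length ys < length xs →
          ∃ λ x → x ∈ xs × x ∉ ys
escapes {xs = xs} {ys} xs! lt with All.all? (λ x → DecMembership._∈?_ _≟_ x ys) xs
... | yes p = contradiction lt (≤⇒≯ (Unique-⊆-length xs! (All.lookup p)))
... | no ¬p = find (Allₚ.¬All⇒Any¬ (λ x → DecMembership._∈?_ _≟_ x ys) xs ¬p)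

------------------------------------------------------------------------
-- Descents

-- The decision of a descent together with the value of the test on which
-- the definitions of the tree branch.
descent? : (x y : Fin n) → (y Fin.< x × does (y <? x) ≡ true) ⊎ (¬ y Fin.< x × does (y <? x) ≡ false)
descent? x y with y <? x
... | yes y<x = inj₁ (y<x , dec-true (y <? x) y<x)
... | no  y≮x = inj₂ (y≮x , dec-false (y <? x) y≮x)

-- The letters at the left of a nondescent, read as labels; one for each
-- nondescent leaf except the rightmost.
nondescentLabels : List (Fin n) → List (Label n)
nondescentLabels []           = []
nondescentLabels (x ∷ [])     = []
nondescentLabels (x ∷ y ∷ ws) =
  if does (y <? x) then nondescentLabels (y ∷ ws) else num x ∷ nondescentLabels (y ∷ ws)

descent-or-nondescent : (ws : Vec (Fin n) m) → ∀ i →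
  num (lookup ws i) ∈ descentLabels (toList ws) ⊎ num (lookup ws i) ∈ nondescentLabels (toList ws)
descent-or-nondescent (x ∷ []) zero = inj₁ (here refl)
descent-or-nondescent (x ∷ y ∷ ws) zero with descent? x y
... | inj₁ (_ , eq) rewrite eq = inj₁ (here refl)
... | inj₂ (_ , eq) rewrite eq = inj₂ (here refl)
descent-or-nondescent (x ∷ y ∷ ws) (suc i) with descent? x y | descent-or-nondescent (y ∷ ws) i
... | inj₁ (_ , eq) | p rewrite eq = Sum.map₁ there p
... | inj₂ (_ , eq) | p rewrite eq = Sum.map₂ there p

descents+nondescents : (ws : List (Fin n)) →
  length (descentLabels ws) + length (nondescentLabels ws) ≡ length ws
descents+nondescents []           = refl
descents+nondescents (x ∷ [])     = refl
descents+nondescents (x ∷ y ∷ ws) with descents+nondescents (y ∷ ws) | descent? x y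
... | ih | inj₁ (_ , eq) rewrite eq = cong suc ih
... | ih | inj₂ (_ , eq) rewrite eq = trans (+-suc _ _) (cong suc ih)

-- Position d is followed by a smaller letter, or it is the last position.
Descent : Vec (Fin n) m → Fin m → Set
Descent ws d = ∀ d⁺ → toℕ d⁺ ≡ suc (toℕ d) → lookup ws d⁺ Fin.< lookup ws d

descentLabels-sound : (ws : Vec (Fin n) m) → ∀ {v} → v ∈ descentLabels (toList ws) →
                      ∃ λ d → v ≡ num (lookup ws d) × Descent ws d
descentLabels-sound (x ∷ []) (here refl) = zero , refl , λ { zero () }
descentLabels-sound {n} (x ∷ y ∷ ws) {v} v∈ with (λ v∈ → descentLabels-sound (y ∷ ws) {v} v∈) | descent? x y
... | ih | inj₁ (y<x , eq) rewrite eq = case v∈ of λ where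
  (here refl) → zero , refl , λ { (suc zero) _ → y<x }
  (there v∈) → let d , v≡ , desc = ih v∈ in
    suc d , v≡ , λ { (suc d⁺) e → desc d⁺ (suc-injective e) }
... | ih | inj₂ (_ , eq) rewrite eq = let d , v≡ , desc = ih v∈ in
    suc d , v≡ , λ { (suc d⁺) e → desc d⁺ (suc-injective e) }

-- A repeated descent label x would come from x > y followed by another x.
descentLabels-unique : (ws : Vec (Fin n) m) → No212 ws → Unique (descentLabels (toList ws))
descentLabels-unique []           avoid = []
descentLabels-unique (x ∷ [])     avoid = [] ∷ []
descentLabels-unique (x ∷ y ∷ ws) avoid
  with descentLabels-unique (y ∷ ws) (No212-tail avoid) | descent? x y
... | ih | inj₂ (_ , eq)   rewrite eq = ih
... | ih | inj₁ (y<x , eq) rewrite eq = All.tabulate fresh ∷ ih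
  where
  fresh : ∀ {v} → v ∈ descentLabels (toList (y ∷ ws)) → num x ≢ v
  fresh v∈ refl with descentLabels-sound (y ∷ ws) v∈
  ... | zero  , refl , _ = <-irrefl refl y<x
  ... | suc d , refl , _ = avoid zero (suc zero) (suc (suc d)) z<s (s<s z<s) (refl , y<x)

------------------------------------------------------------------------
-- Unused labels and the filling of nondescent leaves

Sorted : List (Label n) → Set
Sorted = AllPairs Fin._<_

Sorted⇒Unique : {us : List (Label n)} → Sorted us → Unique us
Sorted⇒Unique = AllPairs.map Finₚ.<⇒≢

-- The list us can label the nondescent leaves of ws: it has one label for
-- each of them, including the rightmost one.
record Supply (us : List (Label n)) (ws : List (Fin n)) : Set where
  field
    sorted   : Sorted us
    size     : length us ≡ suc (length (nondescentLabels ws))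
    disjoint : ∀ {v} → v ∈ us → v ∉ descentLabels ws

-- The labels outnumber the nondescents by one, so one of them is not the
-- letter of a nondescent; being no descent label either, it is no letter.
missing-label : ∀ {us} (ws : Vec (Fin n) m) → Supply us (toList ws) →
                ∃ λ v → v ∈ us × (∀ i → v ≢ num (lookup ws i))
missing-label ws sup
  with escapes (Sorted⇒Unique sorted) (≤-reflexive (sym size))
  where open Supply sup
... | v , v∈us , v∉ = v , v∈us , λ { i refl →
        [ Supply.disjoint sup v∈us , v∉ ]′ (descent-or-nondescent ws i) }

-- The chosen label is smaller than all that are left, except possibly the
-- one that was skipped, which is y.
choose-spec : ∀ (y : Fin n) us {k} → Sorted us → length us ≡ suc (suc k) →
  ∃₂ λ v vs → choose y us ≡ (just v , vs) × us ↭ v ∷ vs × Sorted vs ×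
              (∀ {z} → z ∈ vs → z ≢ num y → v Fin.< z)
choose-spec y (u ∷ u′ ∷ us) ((u<u′ ∷ u<us) ∷ (u′<us ∷ us!)) _ with u ≟ num y
... | no _ = u , u′ ∷ us , refl , ↭-refl , u′<us ∷ us! , λ z∈ _ → All.lookup (u<u′ ∷ u<us) z∈
... | yes refl = u′ , u ∷ us , refl , ↭-swap u u′ ↭-refl , u<us ∷ us! ,
                 λ { (here refl) z≢ → contradiction refl z≢ ; (there z∈) _ → All.lookup u′<us z∈ }

Supply-descent : ∀ {us} {x y : Fin n} {ws} → y Fin.< x → Supply us (x ∷ y ∷ ws) → Supply us (y ∷ ws)
Supply-descent {x = x} {y} y<x sup
  with Supply.size sup | (λ {v} → Supply.disjoint sup {v})
... | size | disjoint rewrite dec-true (y <? x) y<x = record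
  { sorted = Supply.sorted sup ; size = size ; disjoint = λ v∈ → disjoint v∈ ∘ there }

Supply-nondescent : ∀ {us} {x y : Fin n} {ws} → ¬ y Fin.< x → Supply us (x ∷ y ∷ ws) →
  ∃₂ λ v vs → choose y us ≡ (just v , vs) × us ↭ v ∷ vs × Supply vs (y ∷ ws) ×
              (∀ {z} → z ∈ vs → z ≢ num y → v Fin.< z)
Supply-nondescent {us = us} {x} {y} y≮x sup
  with Supply.size sup | (λ {v} → Supply.disjoint sup {v})
... | size | disjoint rewrite dec-false (y <? x) y≮x with choose-spec y us (Supply.sorted sup) size
... | v , vs , eq , us↭ , vs! , v< = v , vs , eq , us↭ , record
  { sorted   = vs!
  ; size     = suc-injective (trans (sym (↭-length us↭)) size)
  ; disjoint = λ v∈ → disjoint (∈-resp-↭ (↭-sym us↭) (there v∈))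
  } , v<

-- The leaves receive the descent labels and the unused labels, each once.
fill-↭ : ∀ us (ws : Vec (Fin n) m) → Supply us (toList ws) →
         toList (fill us ws) ↭ map just (descentLabels (toList ws) ++ us)
fill-↭ (u ∷ []) [] sup = ↭-refl
fill-↭ [] [] record { size = () }
fill-↭ (_ ∷ _ ∷ _) [] record { size = () }
fill-↭ (u ∷ []) (x ∷ []) sup = ↭-refl
fill-↭ [] (x ∷ []) record { size = () }
fill-↭ (_ ∷ _ ∷ _) (x ∷ []) record { size = () }
fill-↭ us (x ∷ y ∷ ws) sup with (λ us → fill-↭ us (y ∷ ws)) | descent? x y
... | ih | inj₁ (y<x , does≡) rewrite does≡ = ↭-prep _ (ih us (Supply-descent y<x sup))
... | ih | inj₂ (y≮x , does≡) with Supply-nondescent y≮x sup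
... | v , vs , eq , us↭ , sup′ , _ rewrite does≡ | eq =
  ↭-trans (↭-prep _ (ih vs sup′))
          (Perm.map⁺ just (↭-trans (↭-sym (shift v (descentLabels (toList (y ∷ ws))) vs))
                                   (++⁺ˡ (descentLabels (toList (y ∷ ws))) (↭-sym us↭))))

∈-fill : ∀ us (ws : Vec (Fin n) m) → Supply us (toList ws) → ∀ s {v} →
         lookup (fill us ws) s ≡ just v → v ∈ descentLabels (toList ws) ⊎ v ∈ us
∈-fill us ws sup s {v} eq
  with ∈-map⁻ just (∈-resp-↭ (fill-↭ us ws sup)
         (∈-toList⁺ (subst (Vec._∈ fill us ws) eq (Vec.∈-lookup s (fill us ws)))))
... | .v , v∈ , refl = ∈-++⁻ (descentLabels (toList ws)) v∈

fill-∈ : ∀ us (ws : Vec (Fin n) m) → Supply us (toList ws) → ∀ {v} → v ∈ us →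
         ∃ λ s → lookup (fill us ws) s ≡ just v
fill-∈ us ws sup v∈ = Vec.index v∈fill , sym (Vec.lookup-index v∈fill)
  where
  v∈fill = ∈-toList⁻ (∈-resp-↭ (↭-sym (fill-↭ us ws sup))
             (∈-map⁺ just (∈-++⁺ʳ (descentLabels (toList ws)) v∈)))

-- A supply for an avoiding word such that each label that is no letter of
-- the word is below all its letters.  This property of suffixes is kept
-- from left to right, and holds for a whole word with right-justified
-- content.
record AvoidingSupply {n m} (us : List (Label n)) (ws : Vec (Fin n) m) : Set where
  field
    supply : Supply us (toList ws)
    no212  : No212 ws
    no23   : No23-2̅-1 ws
    absent : ∀ {v} → v ∈ us → (∀ i → v ≢ num (lookup ws i)) → ∀ i → v Fin.< num (lookup ws i)

-- Some label is below all letters, by missing-label and absent; the least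
-- one is at most that label.
head-small : ∀ {u vs} {ws : Vec (Fin n) m} → AvoidingSupply (u ∷ vs) ws → ∀ i → u Fin.< num (lookup ws i)
head-small {ws = ws} good i with missing-label ws (AvoidingSupply.supply good)
... | v , here refl , v∉ = AvoidingSupply.absent good (here refl) v∉ i
... | v , there v∈ , v∉ with Supply.sorted (AvoidingSupply.supply good)
... | u< ∷ _ = Finₚ.<-trans (All.lookup u< v∈) (AvoidingSupply.absent good (there v∈) v∉ i)

choose-head : ∀ (y : Fin n) u us → u ≢ num y → choose y (u ∷ us) ≡ (just u , us)
choose-head y u us u≢ with u ≟ num y
choose-head y u us       u≢ | no _  = refl
choose-head y u us       u≢ | yes p = contradiction p u≢

head-descent : ∀ {x y : Fin n} ws → y Fin.< x → num x ∈ descentLabels (x ∷ y ∷ ws)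
head-descent {x = x} {y} ws y<x rewrite dec-true (y <? x) y<x = here refl

AvoidingSupply-descent : ∀ {us} {x y : Fin n} {ws : Vec (Fin n) m} → y Fin.< x →
               AvoidingSupply us (x ∷ y ∷ ws) → AvoidingSupply us (y ∷ ws)
AvoidingSupply-descent {ws = ws} y<x good = record
  { supply = Supply-descent y<x supply
  ; no212  = No212-tail no212
  ; no23   = No23-tail no23
  ; absent = λ v∈ v∉ i → absent v∈ (λ { zero refl → Supply.disjoint supply v∈ (head-descent (toList ws) y<x)
                                      ; (suc i) → v∉ i }) (suc i)
  }
  where
  open AvoidingSupply good

-- If x does not occur again after a nondescent, a smaller letter later on
-- would complete the second pattern.
after-last : ∀ {x y : Fin n} {ws : Vec (Fin n) m} → No23-2̅-1 (x ∷ y ∷ ws) → ¬ y Fin.< x →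
             (∀ i → x ≢ lookup (y ∷ ws) i) → ∀ i → x Fin.< lookup (y ∷ ws) i
after-last {x = x} {y} {ws} no23 y≮x x∉ i with i | Finₚ.<-cmp x (lookup (y ∷ ws) i)
... | _     | tri< x< _ _ = x<
... | i     | tri≈ _ eq _ = contradiction eq (x∉ i)
... | zero  | tri> _ _ y<x = contradiction y<x y≮x
... | suc i | tri> _ _ z<x
  with no23 zero (suc zero) (suc (suc i)) refl (s<s z<s) z<x (Finₚ.≤∧≢⇒< (≮⇒≥ y≮x) (x∉ zero))
... | suc s , _ , _ , eq = contradiction (sym eq) (x∉ s)

-- At a nondescent the least label is chosen, and it is below all letters.
record NondescentStep {n m} (us : List (Label n)) (x y : Fin n) (ws : Vec (Fin n) m) : Set where
  field
    u       : Label n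
    vs      : List (Label n)
    us≡     : us ≡ u ∷ vs
    chosen  : choose y us ≡ (just u , vs)
    small   : ∀ i → u Fin.< num (lookup (x ∷ y ∷ ws) i)
    smaller : All (u Fin.<_) vs
    good    : AvoidingSupply vs (y ∷ ws)

AvoidingSupply-nondescent : ∀ us {x y : Fin n} {ws : Vec (Fin n) m} → ¬ y Fin.< x →
                  AvoidingSupply us (x ∷ y ∷ ws) → NondescentStep us x y ws
AvoidingSupply-nondescent [] y≮x good with () ← Supply.size (AvoidingSupply.supply good)
AvoidingSupply-nondescent (u ∷ vs) {x} {y} {ws} y≮x good
  with Supply-nondescent y≮x (AvoidingSupply.supply good)
     | choose-head y u vs (Finₚ.<⇒≢ (head-small good (suc zero)))
     | Supply.sorted (AvoidingSupply.supply good)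
... | v , vs′ , eq , _ , sup , _ | eq′ | u< ∷ _ with trans (sym eq) eq′
... | refl = record
  { u = u ; vs = vs ; us≡ = refl ; chosen = eq′ ; small = head-small good ; smaller = u<
  ; good = record
    { supply = sup
    ; no212  = No212-tail no212
    ; no23   = No23-tail no23
    ; absent = absent′
    }
  }
  where
  open AvoidingSupply good
  absent′ : ∀ {v} → v ∈ vs → (∀ i → v ≢ num (lookup (y ∷ ws) i)) →
            ∀ i → v Fin.< num (lookup (y ∷ ws) i)
  absent′ {v} v∈ v∉ i with v ≟ num x
  ... | no v≢x = absent (there v∈) (λ { zero → v≢x ; (suc i) → v∉ i }) (suc i)
  ... | yes refl = num-mono (after-last no23 y≮x (λ i x≡ → v∉ i (cong (λ z → num z) x≡)) i)

-- Unused labels are handed out in increasing order, and descent labels to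
-- the right are letters, which exceed the label chosen.
nondescent-increases : ∀ {us} (ws : Vec (Fin n) m) → AvoidingSupply us ws → ∀ j j⁺ s {u v} →
  toℕ j⁺ ≡ suc (toℕ j) → lookup ws j Fin.≤ lookup ws j⁺ → toℕ j < toℕ s →
  lookup (fill us ws) (inject₁ j) ≡ just u → lookup (fill us ws) s ≡ just v → u Fin.< v
nondescent-increases (x ∷ []) good zero zero s ()
nondescent-increases {us = us} (x ∷ y ∷ ws) good j (suc j⁺) (suc s) e le lt fu fv
  with (λ us → nondescent-increases {us = us} (y ∷ ws)) | descent? x y
nondescent-increases {us = us} (x ∷ y ∷ ws) good zero (suc zero) (suc s) e le lt fu fv
  | ih | inj₁ (y<x , _) = contradiction y<x (≤⇒≯ le)
nondescent-increases {us = us} (x ∷ y ∷ ws) good (suc j) (suc j⁺) (suc s) e le lt fu fv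
  | ih | inj₁ (y<x , does≡) rewrite does≡ =
  ih us (AvoidingSupply-descent y<x good) j j⁺ s (suc-injective e) le (s<s⁻¹ lt) fu fv
nondescent-increases {us = us} (x ∷ y ∷ ws) good j (suc j⁺) (suc s) e le lt fu fv
  | ih | inj₂ (y≮x , does≡) with AvoidingSupply-nondescent us y≮x good
... | record { u = u ; vs = vs ; us≡ = refl ; chosen = chosen ; small = small ; smaller = smaller
             ; good = good′ }
  rewrite does≡ | chosen with j | fu
... | suc j | fu = ih vs good′ j j⁺ s (suc-injective e) le (s<s⁻¹ lt) fu fv
... | zero  | refl with ∈-fill vs (y ∷ ws) (AvoidingSupply.supply good′) s fv
... | inj₂ v∈ = All.lookup smaller v∈
... | inj₁ v∈ with descentLabels-sound (y ∷ ws) v∈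
... | d , refl , _ = small (suc d)

-- Condition (A), for a leaf index s counting the leaves from the one after
-- the first letter: leaf s lies beyond edge i exactly if i ≤ s.
own-label-after : ∀ {us} (ws : Vec (Fin n) m) → AvoidingSupply us ws → ∀ i s →
  lookup (fill us ws) s ≡ just (num (lookup ws i)) →
  i Fin.≤ s × (∀ j → i Fin.< j → toℕ j ≤ toℕ s → lookup ws i Fin.≤ lookup ws j)
own-label-after (x ∷ []) good zero s _ = z≤n , λ { zero () }
own-label-after {us = us} (x ∷ y ∷ ws) good i s fs
  with (λ us → own-label-after {us = us} (y ∷ ws)) | descent? x y
own-label-after {us = us} (x ∷ y ∷ ws) good zero s fs | ih | inj₁ (y<x , does≡) rewrite does≡ with s | fs
... | zero  | _ = z≤n , λ { (suc j) _ () }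
... | suc s | fs with ∈-fill us (y ∷ ws) (AvoidingSupply.supply (AvoidingSupply-descent y<x good)) s fs
... | inj₂ x∈us = contradiction (head-descent (toList ws) y<x)
                    (Supply.disjoint (AvoidingSupply.supply good) x∈us)
... | inj₁ x∈ with descentLabels-sound (y ∷ ws) x∈
... | zero  , refl , _ = contradiction y<x (<-irrefl refl)
... | suc d , refl , _ = contradiction (refl , y<x)
  (AvoidingSupply.no212 good zero (suc zero) (suc (suc d)) z<s (s<s z<s))
own-label-after {us = us} (x ∷ y ∷ ws) good (suc i) s fs | ih | inj₁ (y<x , does≡) rewrite does≡ with s | fs
... | suc s | fs = let i≤s , between = ih us (AvoidingSupply-descent y<x good) i s fs in
  s≤s i≤s , λ { (suc j) i<j j≤s → between j (s<s⁻¹ i<j) (s≤s⁻¹ j≤s) }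
... | zero  | fs with i | just-injective fs
... | zero  | refl = contradiction y<x (<-irrefl refl)
... | suc i | refl = contradiction (refl , y<x)
  (AvoidingSupply.no212 good zero (suc zero) (suc (suc i)) z<s (s<s z<s))
own-label-after {us = us} (x ∷ y ∷ ws) good i s fs | ih | inj₂ (y≮x , does≡)
  with AvoidingSupply-nondescent us y≮x good
... | record { u = u ; vs = vs ; us≡ = refl ; chosen = chosen ; small = small ; good = good′ }
  rewrite does≡ | chosen with s | fs
... | zero  | refl = contradiction (small i) (<-irrefl refl)
... | suc s | fs with i
... | suc i = let i≤s , between = ih vs good′ i s fs in
  s≤s i≤s , λ { (suc j) i<j j≤s → between j (s<s⁻¹ i<j) (s≤s⁻¹ j≤s) }
... | zero with Finₚ.any? (λ i → x ≟ lookup (y ∷ ws) i)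
... | no x∉ = z≤n , λ { (suc j) _ _ → <⇒≤ (after-last (AvoidingSupply.no23 good) y≮x (λ i x≡ → x∉ (i , x≡)) j) }
... | yes (i , refl) = z≤n , between
  where
  between : ∀ j → 0 < toℕ j → toℕ j ≤ suc (toℕ s) → x Fin.≤ lookup (x ∷ y ∷ ws) j
  between (suc j) _ j≤s with Finₚ.<-cmp i j
  ... | tri< i<j _ _  = proj₂ (ih vs good′ i s fs) j i<j (s≤s⁻¹ j≤s)
  ... | tri≈ _ refl _ = ≤-refl
  ... | tri> _ _ j<i  = ≮⇒≥ λ lt → AvoidingSupply.no212 good zero (suc j) (suc i) z<s (s<s j<i) (refl , lt)

-- After the gap g has received the label v, some larger label v′ that is
-- no letter of the rest of the word remains; it is placed to the right.
next-label : ∀ {us} (ws : Vec (Fin n) m) → Supply us (toList ws) → ∀ g {v} →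
  lookup (fill us ws) g ≡ just v → v ∉ descentLabels (toList ws) → suc (toℕ g) < m →
  ∃₂ λ v′ g′ → v Fin.< v′ × g Fin.< g′ × lookup (fill us ws) g′ ≡ just v′ × v′ ∈ us ×
               (∀ i → toℕ g < toℕ i → v′ ≢ num (lookup ws i))
next-label (x ∷ []) sup g fg v∉ (s≤s ())
next-label {us = us} (x ∷ y ∷ ws) sup g fg v∉ g<m
  with (λ us → next-label {us = us} (y ∷ ws)) | descent? x y
next-label {us = us} (x ∷ y ∷ ws) sup zero fg v∉ g<m | ih | inj₁ (y<x , does≡) rewrite does≡ with refl ← fg =
  contradiction (here refl) v∉
next-label {us = us} (x ∷ y ∷ ws) sup (suc g) fg v∉ g<m | ih | inj₁ (y<x , does≡) rewrite does≡
  with ih us (Supply-descent y<x sup) g fg (v∉ ∘ there) (s<s⁻¹ g<m)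
... | v′ , g′ , v<v′ , g<g′ , fg′ , v′∈ , v′∉ =
  v′ , suc g′ , v<v′ , s<s g<g′ , fg′ , v′∈ , λ { (suc i) g<i → v′∉ i (s<s⁻¹ g<i) }
next-label {us = us} (x ∷ y ∷ ws) sup g fg v∉ g<m | ih | inj₂ (y≮x , does≡)
  with Supply-nondescent y≮x sup
... | v , vs , chosen , us↭ , sup′ , v< rewrite does≡ | chosen with g | fg
... | suc g | fg with ih vs sup′ g fg v∉ (s<s⁻¹ g<m)
... | v′ , g′ , v<v′ , g<g′ , fg′ , v′∈ , v′∉ =
  v′ , suc g′ , v<v′ , s<s g<g′ , fg′ , ∈-resp-↭ (↭-sym us↭) (there v′∈) , λ { (suc i) g<i → v′∉ i (s<s⁻¹ g<i) }
next-label {us = us} (x ∷ y ∷ ws) sup g fg v∉ g<m | ih | inj₂ (y≮x , does≡)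
    | v , vs , chosen , us↭ , sup′ , v< | zero | refl with missing-label (y ∷ ws) sup′
... | v′ , v′∈ , v′∉ with fill-∈ vs (y ∷ ws) sup′ v′∈
... | g′ , fg′ = v′ , suc g′ , v< v′∈ (v′∉ zero) , z<s , fg′ , ∈-resp-↭ (↭-sym us↭) (there v′∈) ,
                 λ { (suc i) _ → v′∉ i }

------------------------------------------------------------------------
-- The leaf labels of a whole word

-- All labels except a and b.
properLabels : ∀ n → List (Label n)
properLabels n = c ∷ map (λ i → num i) (allFin n)

properLabels-sorted : ∀ n → Sorted (properLabels n)
properLabels-sorted n =
  Allₚ.map⁺ (All.tabulate λ _ → s<s (s<s z<s)) ∷
  AllPairsₚ.map⁺ (AllPairsₚ.tabulate⁺-< num-mono)

num∈properLabels : (x : Fin n) → num x ∈ properLabels n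
num∈properLabels x = there (∈-map⁺ (λ i → num i) (∈-allFin x))

unused? : (ws : List (Fin n)) (x : Label n) → Dec (x ∉ descentLabels ws)
unused? ws x = ¬? (DecMembership._∈?_ _≟_ x (descentLabels ws))

∈-unused⁻ : ∀ (ws : List (Fin n)) {v} → v ∈ unusedLabels ws → v ∈ properLabels n × v ∉ descentLabels ws
∈-unused⁻ {n} ws = ∈-filter⁻ (unused? ws) {xs = properLabels n}

unusedLabels-sorted : (ws : List (Fin n)) → Sorted (unusedLabels ws)
unusedLabels-sorted {n} ws = AllPairsₚ.filter⁺ (unused? ws) (properLabels-sorted n)

unused-↭ : (w : Vec (Fin n) m) → No212 w →
           descentLabels (toList w) ++ unusedLabels (toList w) ↭ properLabels n
unused-↭ {n} w avoid = ∼bag⇒↭ (unique∧set⇒bag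
    (Uniqueₚ.++⁺ (descentLabels-unique w avoid)
                 (Sorted⇒Unique (unusedLabels-sorted (toList w)))
                 (λ (v∈D , v∈U) → proj₂ (∈-unused⁻ (toList w) v∈U) v∈D))
    (Sorted⇒Unique (properLabels-sorted n))
    (mk⇔ to from))
  where
  D = descentLabels (toList w)
  to : ∀ {v} → v ∈ D ++ unusedLabels (toList w) → v ∈ properLabels n
  to v∈ with ∈-++⁻ D v∈
  ... | inj₂ v∈U = proj₁ (∈-unused⁻ (toList w) v∈U)
  ... | inj₁ v∈D with descentLabels-sound w v∈D
  ... | d , refl , _ = num∈properLabels (lookup w d)
  from : ∀ {v} → v ∈ properLabels n → v ∈ D ++ unusedLabels (toList w)
  from {v} v∈ with DecMembership._∈?_ _≟_ v D
  ... | yes v∈D = ∈-++⁺ˡ v∈D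
  ... | no  v∉D = ∈-++⁺ʳ D (∈-filter⁺ (unused? (toList w)) v∈ v∉D)

unused-supply : (w : Word n) → No212 w → Supply (unusedLabels (toList w)) (toList w)
unused-supply {n} w avoid = record
  { sorted   = unusedLabels-sorted (toList w)
  ; size     = +-cancelˡ-≡ (length D) _ _ (begin
      length D + length (unusedLabels (toList w))        ≡⟨ length-++ D ⟨
      length (D ++ unusedLabels (toList w))              ≡⟨ ↭-length (unused-↭ w avoid) ⟩
      suc (length (map (λ i → num i) (allFin n)))        ≡⟨ cong suc (length-map _ (allFin n)) ⟩
      suc (length (allFin n))                            ≡⟨ cong suc (length-tabulate id) ⟩
      suc n                                              ≡⟨ cong suc (Vecₚ.length-toList w) ⟨
      suc (length (toList w))                            ≡⟨ cong suc (descents+nondescents (toList w)) ⟨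
      suc (length D + length (nondescentLabels (toList w))) ≡⟨ +-suc _ _ ⟨
      length D + suc (length (nondescentLabels (toList w))) ∎)
  ; disjoint = λ v∈ → proj₂ (∈-unused⁻ (toList w) v∈)
  }
  where
  open ≡-Reasoning
  D = descentLabels (toList w)

leafLabels-↭ : (w : Word n) → No212 w → toList (leafLabels w) ↭ map just (allFin (suc (suc (suc n))))
leafLabels-↭ {n} w avoid =
  ↭-prep _ (↭-prep _ (↭-trans (fill-↭ _ w (unused-supply w avoid))
    (↭-trans (Perm.map⁺ just (unused-↭ w avoid))
             (↭-reflexive (cong (λ xs → map just (c ∷ xs)) (map-tabulate id (λ i → num i)))))))

toList-Unique : ∀ {A : Set} {xs : Vec A m} → Unique (toList xs) → ∀ i j →
                lookup xs i ≡ lookup xs j → i ≡ j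
toList-Unique {xs = x ∷ xs} (_ ∷ _)   zero    zero    _  = refl
toList-Unique {xs = x ∷ xs} (px ∷ _)  zero    (suc j) eq =
  contradiction eq (All.lookup px (∈-toList⁺ (Vec.∈-lookup j xs)))
toList-Unique {xs = x ∷ xs} (px ∷ _)  (suc i) zero    eq =
  contradiction (sym eq) (All.lookup px (∈-toList⁺ (Vec.∈-lookup i xs)))
toList-Unique {xs = x ∷ xs} (_ ∷ pxs) (suc i) (suc j) eq = cong suc (toList-Unique pxs i j eq)

-- Abstract, since only this specification of the position of a label is
-- ever used.
abstract
  leaf-exists : (w : Word n) → No212 w → ∀ x → ∃ λ p → lookup (leafLabels w) p ≡ just x
  leaf-exists w avoid x =
    let x∈ = ∈-toList⁻ (∈-resp-↭ (↭-sym (leafLabels-↭ w avoid)) (∈-map⁺ just (∈-allFin x)))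
    in Vec.index x∈ , sym (Vec.lookup-index x∈)

leaf-unique : (w : Word n) → No212 w → ∀ p q →
              lookup (leafLabels w) p ≡ lookup (leafLabels w) q → p ≡ q
leaf-unique w avoid = toList-Unique (SetoidPerm.Unique-resp-↭ (setoid _) (↭⇒↭ₛ (↭-sym (leafLabels-↭ w avoid)))
                        (Uniqueₚ.map⁺ just-injective (Uniqueₚ.allFin⁺ _)))

leaf-labelled : (w : Word n) → No212 w → ∀ p → ∃ λ x → lookup (leafLabels w) p ≡ just x
leaf-labelled w avoid p
  with ∈-map⁻ just (∈-resp-↭ (leafLabels-↭ w avoid) (∈-toList⁺ (Vec.∈-lookup p (leafLabels w))))
... | x , _ , eq = x , eq

------------------------------------------------------------------------
-- Words with right-justified content

count≡0 : (ws : Vec (Fin n) m) (x : Fin n) → (∀ i → x ≢ lookup ws i) → Vec.count (x ≟_) ws ≡ 0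
count≡0 []       x x∉ = refl
count≡0 (y ∷ ws) x x∉ rewrite dec-false (x ≟ y) (x∉ zero) = count≡0 ws x (x∉ ∘ suc)

count≢0 : (ws : Vec (Fin n) m) → ∀ i → Vec.count (lookup ws i ≟_) ws ≢ 0
count≢0 (y ∷ ws) zero    eq rewrite dec-true (y ≟ y) refl = case eq of λ ()
count≢0 (y ∷ ws) (suc i) eq with does (lookup ws i ≟ y)
... | false = count≢0 ws i eq
... | true  = case eq of λ ()

-- Avoidance and condition (A) for words with right-justified content.
module _ {n} (w : Word n) (k : Vec ℕ n) (justified : RightJustified k) (content : HasContent w k) where

  -- Letters that do not occur are below those that do, as the content is
  -- right-justified.
  absent-small : ∀ x → (∀ i → x ≢ lookup w i) → ∀ i → x Fin.< lookup w i
  absent-small x x∉ i = justified x (lookup w i) (trans (sym (content x)) (count≡0 w x x∉))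
    (λ eq → count≢0 w i (trans (content (lookup w i)) eq))

  -- Condition (A).
  OwnLabelsAfter : Set
  OwnLabelsAfter = ∀ i s → lookup (fill (unusedLabels (toList w)) w) s ≡ just (num (lookup w i)) →
    i Fin.≤ s × (∀ j → i Fin.< j → toℕ j ≤ toℕ s → lookup w i Fin.≤ lookup w j)

  avoids⇒AvoidingSupply : Avoids-2-1-2 w → Avoids-23-2̅-1 w → AvoidingSupply (unusedLabels (toList w)) w
  avoids⇒AvoidingSupply no212 no23 = record
    { supply = unused-supply w no212
    ; no212  = no212
    ; no23   = no23
    ; absent = absent
    }
    where
    absent : ∀ {v} → v ∈ unusedLabels (toList w) → (∀ i → v ≢ num (lookup w i)) →
             ∀ i → v Fin.< num (lookup w i)
    absent v∈ v∉ i with ∈-unused⁻ (toList w) v∈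
    ... | here refl , _ = s<s (s<s z<s)
    ... | there v∈′ , _ with ∈-map⁻ (λ i → num i) v∈′
    ... | x , _ , refl = num-mono (absent-small x (λ i x≡ → v∉ i (cong (λ z → num z) x≡)) i)

  module _ (labelled : ∀ i → ∃ λ s → lookup (fill (unusedLabels (toList w)) w) s ≡ just (num (lookup w i)))
           (after : OwnLabelsAfter) where

    after⇒no212 : Avoids-2-1-2 w
    after⇒no212 p q r p<q q<r (wp≡wr , wq<wr) with labelled r
    ... | s , fs = contradiction (subst (lookup w q Fin.<_) (sym wp≡wr) wq<wr) (≤⇒≯
      (proj₂ (after p s (trans fs (cong (λ z → just (num z)) (sym wp≡wr)))) q p<q
        (≤-trans (<⇒≤ q<r) (proj₁ (after r s fs)))))

    -- Letter i precedes the smaller letter q, and its label is not that of a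
    -- descent leaf.  By (A) the label is placed before q, and next-label
    -- produces another letter of the same kind with a label further right;
    -- hence the induction from right to left.
    no-late-label : ∀ q i g → Acc Fin._>_ g → i Fin.< q → lookup w q Fin.< lookup w i →
      num (lookup w i) ∉ descentLabels (toList w) →
      lookup (fill (unusedLabels (toList w)) w) g ≢ just (num (lookup w i))
    no-late-label q i g (acc rec) i<q wq<wi ∉D fg with toℕ g ℕₚ.<? toℕ q
    ... | no ≮ = <⇒≱ wq<wi (proj₂ (after i g fg) q i<q (≮⇒≥ ≮))
    ... | yes g<q
      with next-label w (unused-supply w after⇒no212) g fg ∉D (≤-<-trans g<q (toℕ<n q))
    ... | v , g′ , v> , g<g′ , fg′ , v∈ , v∉ with ∈-unused⁻ (toList w) v∈
    ... | here refl , _ = case v> of λ { (s≤s (s≤s ())) }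
    ... | there v∈′ , v∉D with ∈-map⁻ (λ i → num i) v∈′
    ... | x , _ , refl with Finₚ.any? (λ i → x ≟ lookup w i)
    -- A letter exceeding an occurring one occurs, since the content is
    -- right-justified.
    ... | no x∉ = <-asym (num-cancel v>) (absent-small x (λ i eq → x∉ (i , eq)) i)
    ... | yes (i′ , refl) = no-late-label q i′ g′ (rec g<g′)
      (≤-<-trans (≮⇒≥ λ g<i′ → v∉ i′ g<i′ refl) g<q) (<-trans wq<wi (num-cancel v>)) v∉D fg′

    after⇒no23 : Avoids-23-2̅-1 w
    after⇒no23 p p⁺ q p⁺≡ p⁺<q wq<wp wp<wp⁺
      with Finₚ.any? (λ s → (p⁺ Finₚ.<? s) ×-dec (s Finₚ.<? q) ×-dec (lookup w s ≟ lookup w p))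
    ... | yes found = found
    ... | no ¬found with labelled p
    ... | s , fs = contradiction fs (no-late-label q p s (>-wellFounded s) p<q wq<wp ∉D)
      where
      p<p⁺ : p Fin.< p⁺
      p<p⁺ = ≤-reflexive (sym p⁺≡)
      p<q : p Fin.< q
      p<q = <-trans p<p⁺ p⁺<q
      ∉D : num (lookup w p) ∉ descentLabels (toList w)
      -- An occurrence d of w_p with the property of Descent gives 2-1-2 if
      -- d < p or q < d; otherwise it lies between p⁺ and q.
      ∉D ∈D with descentLabels-sound w ∈D
      ... | d , eq , desc with Finₚ.<-cmp d p | Finₚ.suc-injective (Finₚ.suc-injective (Finₚ.suc-injective eq))
      ... | tri≈ _ refl _ | _ = <-asym wp<wp⁺ (desc p⁺ p⁺≡)
      ... | tri< d<p _ _ | wp≡wd with Finₚ.<-cmp d⁺ p | desc d⁺ d⁺≡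
        where
        d⁺ : Fin n
        d⁺ = fromℕ< (≤-<-trans d<p (toℕ<n p))
        d⁺≡ : toℕ d⁺ ≡ suc (toℕ d)
        d⁺≡ = Finₚ.toℕ-fromℕ< _
      ... | tri< d⁺<p _ _ | w< = after⇒no212 d _ p (≤-reflexive (sym (Finₚ.toℕ-fromℕ< _))) d⁺<p
        (sym wp≡wd , subst (lookup w (fromℕ< (≤-<-trans d<p (toℕ<n p))) Fin.<_) (sym wp≡wd) w<)
      ... | tri≈ _ d⁺≡p _ | w< = <-irrefl (cong toℕ wp≡wd) (subst (λ z → lookup w z Fin.< lookup w d) d⁺≡p w<)
      ... | tri> _ _ p<d⁺ | _  = <⇒≱ p<d⁺ (≤-trans (≤-reflexive (Finₚ.toℕ-fromℕ< _)) d<p)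
      ∉D ∈D | d , eq , desc | tri> _ _ p<d | wp≡wd with Finₚ.<-cmp p⁺ d | Finₚ.<-cmp d q
      ... | tri≈ _ refl _ | _ = <-irrefl (cong toℕ wp≡wd) wp<wp⁺
      ... | tri> _ _ d<p⁺ | _ = <⇒≱ d<p⁺ (≤-trans (≤-reflexive p⁺≡) p<d)
      ... | tri< p⁺<d _ _ | tri< d<q _ _ = ¬found (d , p⁺<d , d<q , sym wp≡wd)
      ... | tri< _ _ _ | tri≈ _ refl _ = <-irrefl (cong toℕ (sym wp≡wd)) wq<wp
      ... | tri< _ _ _ | tri> _ _ q<d =
        after⇒no212 p q d p<q q<d (wp≡wd , subst (lookup w q Fin.<_) wp≡wd wq<wp)

------------------------------------------------------------------------
-- Bridges

-- A 2-coloring of the vertices witnessing that e₀ is a bridge: e₀ is the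
-- only edge whose ends have different colors.
record Bridge (G : Graph) (e₀ : Graph.Edge G) : Set where
  open Graph G
  field
    side   : Vertex → Bool
    cong-≈ : ∀ {u v} → u ≈ v → side u ≡ side v
    near   : side (source e₀) ≡ false
    far    : side (target e₀) ≡ true
    others : ∀ e → e ≡ e₀ ⊎ side (source e) ≡ side (target e)

visits-start : ∀ {G : Graph} {u v x} → Graph._≈_ G u x → (p : Walk G u v) →
               Any (λ z → Graph._≈_ G z x) (visited p)
visits-start u≈x (stop _)     = here u≈x
visits-start u≈x (step _ _ _) = here u≈x

module _ {G : Graph} {e₀ : Graph.Edge G} (bridge : Bridge G e₀) where
  open Graph G
  open Bridge bridge
  open Setoid vertices using () renaming (sym to ≈-sym; trans to ≈-trans)

  same-side : ∀ {e u v} → side (source e) ≡ side (target e) → Joins e u v → side u ≡ side v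
  same-side same (inj₁ (s≈u , t≈v)) = trans (sym (cong-≈ s≈u)) (trans same (cong-≈ t≈v))
  same-side same (inj₂ (s≈v , t≈u)) = trans (sym (cong-≈ t≈u)) (trans (sym same) (cong-≈ s≈v))

  -- A walk between the two sides uses the bridge, hence visits both its ends.
  crossing : ∀ {u v} (p : Walk G u v) → side u ≢ side v →
             e₀ ∈ edges p × Any (_≈ source e₀) (visited p) × Any (_≈ target e₀) (visited p)
  crossing (stop u≈v) ≢ = contradiction (cong-≈ u≈v) ≢
  crossing (step e j p) ≢ with others e | j
  ... | inj₁ refl | inj₁ (s≈u , t≈v) =
    here refl , here (≈-sym s≈u) , there (visits-start (≈-sym t≈v) p)
  ... | inj₁ refl | inj₂ (s≈v , t≈u) =
    here refl , there (visits-start (≈-sym s≈v) p) , here (≈-sym t≈u)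
  ... | inj₂ same | j′ =
    let e∈ , s∈ , t∈ = crossing p (≢ ∘ trans (same-side same j′))
    in there e∈ , there s∈ , there t∈

  -- A path that starts and ends on the near side does not use the bridge, as
  -- it would visit the near end twice.
  no-return : ∀ {u v} (p : Walk G u v) → IsPath p → side u ≡ false → side v ≡ false → e₀ ∉ edges p
  no-return (step e j p) (u≉ ∷ p!) u-near v-near e₀∈ with others e | j
  ... | inj₁ refl | inj₁ (s≈u , t≈v)
    = let _ , s∈ , _ = crossing p λ eq →
                         case trans (sym far) (trans (cong-≈ t≈v) (trans eq v-near)) of λ ()
      in All.lookupWith (λ u≉z z≈s → u≉z (≈-sym (≈-trans z≈s s≈u))) u≉ s∈
  ... | inj₁ refl | inj₂ (s≈v , t≈u) = case trans (sym far) (trans (cong-≈ t≈u) u-near) of λ ()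
  ... | inj₂ same | j′ with e₀∈
  ... | here refl = case trans (sym near) (trans same far) of λ ()
  ... | there e₀∈ = no-return p p! (trans (sym (same-side same j′)) u-near) v-near e₀∈

  ends-differ : ∀ {u v} → Joins e₀ u v → side u ≢ side v
  ends-differ (inj₁ (s≈u , t≈v)) eq =
    case trans (sym near) (trans (cong-≈ s≈u) (trans eq (trans (sym (cong-≈ t≈v)) far))) of λ ()
  ends-differ (inj₂ (s≈v , t≈u)) eq =
    case trans (sym far) (trans (cong-≈ t≈u) (trans eq (trans (sym (cong-≈ s≈v)) near))) of λ ()

  -- Contracting other edges identifies only vertices on the same side.
  contract-bridge : ∀ S → (e₀∉S : e₀ ∉ S) → Bridge (contract G S) (e₀ , [ e₀∉S ])
  contract-bridge S e₀∉S = record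
    { side   = side
    ; cong-≈ = Equivalence.gfold isEquivalence side λ where
        (inj₁ u≈v)            → cong-≈ u≈v
        (inj₂ (e , e∈S , j)) → case others e of λ where
          (inj₁ refl) → contradiction e∈S e₀∉S
          (inj₂ same) → same-side same j
    ; near   = near
    ; far    = far
    ; others = λ { (e , e∉S) → Sum.map₁ (λ { refl → refl }) (others e) }
    }

-- The rest of a closed walk returns over its first edge.
bridges⇒acyclic : ∀ {G : Graph} → (∀ e → Bridge G e) → ∀ {v} (p : Walk G v v) →
                  Unique (edges p) → edges p ≡ []
bridges⇒acyclic bridge (stop _)     _        = refl
bridges⇒acyclic bridge (step e j p) (e∉ ∷ _) =
  contradiction refl (All.lookup e∉ (proj₁ (crossing (bridge e) p (ends-differ (bridge e) j ∘ sym))))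

------------------------------------------------------------------------
-- The caterpillar

Vertices Edges : ℕ → Set
Vertices n = Graph.Vertex (caterpillar n)
Edges n    = Graph.Edge (caterpillar n)

-- The number of internal edges between a vertex and the root.
depth : Vertices n → ℕ
depth (inj₁ x) = toℕ x
depth (inj₂ p) = toℕ (attach p)

_≟ⱽ_ : (u v : Vertices n) → Dec (u ≡ v)
_≟ⱽ_ = ≡-dec _≟_ _≟_

-- The far side of spine edge i consists of the vertices of depth above i,
-- that of a leaf edge of the leaf alone.
caterpillar-bridge : (e : Edges n) → Bridge (caterpillar n) e
caterpillar-bridge {n} (inj₁ i) = record
  { side   = λ v → does (toℕ i ℕₚ.<? depth v)
  ; cong-≈ = cong _
  ; near   = dec-false (_ ℕₚ.<? _) (λ lt → <-irrefl (sym (toℕ-inject₁ i)) lt)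
  ; far    = dec-true (toℕ i ℕₚ.<? suc (toℕ i)) (n<1+n _)
  ; others = λ where
      (inj₂ p) → inj₂ refl
      (inj₁ j) → case Finₚ.<-cmp i j of λ where
        (tri< i<j _ _)  → inj₂ (trans (dec-true (toℕ i ℕₚ.<? _) (subst (toℕ i <_) (sym (toℕ-inject₁ j)) i<j))
                                 (sym (dec-true (toℕ i ℕₚ.<? suc (toℕ j)) (m<n⇒m<1+n i<j))))
        (tri≈ _ refl _) → inj₁ refl
        (tri> ¬i<j _ j<i) → inj₂ (trans (dec-false (toℕ i ℕₚ.<? _) (¬i<j ∘ subst (toℕ i <_) (toℕ-inject₁ j)))
                                 (sym (dec-false (toℕ i ℕₚ.<? suc (toℕ j)) (λ lt → <⇒≱ j<i (s≤s⁻¹ lt)))))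
  }
caterpillar-bridge {n} (inj₂ p) = record
  { side   = λ v → does (v ≟ⱽ inj₂ p)
  ; cong-≈ = cong _
  ; near   = refl
  ; far    = dec-true (inj₂ p ≟ⱽ inj₂ p) refl
  ; others = λ where
      (inj₁ i) → inj₂ refl
      (inj₂ q) → case q ≟ p of λ where
        (yes refl) → inj₁ refl
        (no q≢p)   → inj₂ (sym (dec-false (inj₂ q ≟ⱽ inj₂ p) (q≢p ∘ inj₂-injective)))
  }

-- Leaf position x + 1 hangs at spine vertex x.
attach-inject₁ : (x : Fin (suc n)) → attach (suc (inject₁ x)) ≡ x
attach-inject₁ {n} = pinch-inject₁ n
  where
  pinch-inject₁ : ∀ n (x : Fin (suc n)) → pinch (fromℕ n) (inject₁ x) ≡ x
  pinch-inject₁ n       zero    = refl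
  pinch-inject₁ (suc n) (suc x) = cong suc (pinch-inject₁ n x)

-- The last leaf also hangs at the last spine vertex.
attach-last : attach {n} (suc (fromℕ (suc n))) ≡ fromℕ n
attach-last {n} = pinch-last n
  where
  pinch-last : ∀ n → pinch (fromℕ n) (fromℕ (suc n)) ≡ fromℕ n
  pinch-last zero    = refl
  pinch-last (suc n) = cong suc (pinch-last n)

-- The leaf at position p lies beyond spine edge i exactly if p > i + 1.
<attach⇒ : (i : Fin n) (p : Fin (suc (suc (suc n)))) → toℕ i < toℕ (attach p) → suc (toℕ i) < toℕ p
<attach⇒ {n} i (suc q) = s<s ∘ go n i q
  where
  go : ∀ n (i : Fin n) q → toℕ i < toℕ (pinch (fromℕ n) q) → toℕ i < toℕ q
  go (suc n) zero    (suc q) _  = z<s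
  go (suc n) (suc i) (suc q) lt = s<s (go n i q (s<s⁻¹ lt))

<attach⇐ : (i : Fin n) (p : Fin (suc (suc (suc n)))) → suc (toℕ i) < toℕ p → toℕ i < toℕ (attach p)
<attach⇐ {n} i (suc q) = go n i q ∘ s<s⁻¹
  where
  go : ∀ n (i : Fin n) q → toℕ i < toℕ q → toℕ i < toℕ (pinch (fromℕ n) q)
  go (suc n) zero    (suc q) _  = z<s
  go (suc n) (suc i) (suc q) lt = s<s (go n i q (s<s⁻¹ lt))

------------------------------------------------------------------------
-- The tree of a word is stable

leaf-isLeaf : (p : Fin (suc (suc (suc n)))) → Graph.IsLeaf (caterpillar n) (inj₂ p)
leaf-isLeaf {n} p = inj₂ p , inj₂ refl , only
  where
  only : ∀ {e} → Graph.Incident (caterpillar n) (inj₂ p) e → inj₂ p ≡ e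
  only {inj₁ i} (inj₁ ())
  only {inj₁ i} (inj₂ ())
  only {inj₂ q} (inj₁ ())
  only {inj₂ q} (inj₂ refl) = refl

spine-degree : n ≢ 0 → (x : Fin (suc n)) → Graph.DegreeAtLeast (caterpillar n) 3 (inj₁ x)
spine-degree {zero}  n≢0 _       = contradiction refl n≢0
spine-degree {suc n} _   zero    =
  inj₁ zero ∷ inj₂ zero ∷ inj₂ (suc zero) ∷ [] , ≤-refl ,
  ((λ ()) ∷ (λ ()) ∷ []) ∷ ((λ ()) ∷ []) ∷ [] ∷ [] ,
  inj₁ refl ∷ inj₁ refl ∷ inj₁ refl ∷ []
spine-degree {suc n} _   (suc y) with view y
... | ‵fromℕ =
  inj₁ (fromℕ n) ∷ inj₂ (suc (fromℕ (suc (suc n)))) ∷ inj₂ (suc (inject₁ (fromℕ (suc n)))) ∷ [] , ≤-refl ,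
  ((λ ()) ∷ (λ ()) ∷ []) ∷
  ((λ eq → Finₚ.fromℕ≢inject₁ (Finₚ.suc-injective (inj₂-injective eq))) ∷ []) ∷ [] ∷ [] ,
  inj₂ refl ∷ inj₁ (cong inj₁ attach-last) ∷ inj₁ (cong inj₁ (attach-inject₁ (fromℕ (suc n)))) ∷ []
... | ‵inj₁ {i = z} _ =
  inj₁ (inject₁ z) ∷ inj₁ (suc z) ∷ inj₂ (suc (inject₁ (suc (inject₁ z)))) ∷ [] , ≤-refl ,
  ((λ eq → <-irrefl (trans (sym (toℕ-inject₁ z)) (cong toℕ (inj₁-injective eq))) ≤-refl) ∷ (λ ()) ∷ []) ∷
  ((λ ()) ∷ []) ∷ [] ∷ [] ,
  inj₂ refl ∷ inj₁ refl ∷ inj₁ (cong inj₁ (attach-inject₁ (suc (inject₁ z)))) ∷ []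

spine-notLeaf : n ≢ 0 → (x : Fin (suc n)) → ¬ Graph.IsLeaf (caterpillar n) (inj₁ x)
spine-notLeaf n≢0 x (e , _ , unique) with spine-degree n≢0 x
... | e₁ ∷ e₂ ∷ _ , _ , (e₁≢e₂ ∷ _) ∷ _ , inc₁ ∷ inc₂ ∷ _ = e₁≢e₂ (trans (sym (unique inc₁)) (unique inc₂))
... | _ ∷ [] , s≤s () , _

walk-trans : ∀ {G : Graph} {u v w} → Walk G u v → Walk G v w → Walk G u w
walk-trans {G} (stop u≈v)  q = glue u≈v q
  where
  open Graph G
  open Setoid vertices using () renaming (trans to ≈-trans; sym to ≈-sym)
  glue : ∀ {u v w} → u ≈ v → Walk G v w → Walk G u w
  glue u≈v (stop v≈w)   = stop (≈-trans u≈v v≈w)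
  glue u≈v (step e (inj₁ (s≈v , t≈w)) p) = step e (inj₁ (≈-trans s≈v (≈-sym u≈v) , t≈w)) p
  glue u≈v (step e (inj₂ (s≈w , t≈v)) p) = step e (inj₂ (s≈w , ≈-trans t≈v (≈-sym u≈v))) p
walk-trans (step e j p) q = step e j (walk-trans p q)

walk-sym : ∀ {G : Graph} {u v} → Walk G u v → Walk G v u
walk-sym {G} (stop u≈v)   = stop (Setoid.sym (Graph.vertices G) u≈v)
walk-sym {G} (step e j p) =
  walk-trans (walk-sym p) (step e (Sum.swap j) (stop (Setoid.refl (Graph.vertices G))))

caterpillar-isTree : ∀ n → IsTree (caterpillar n)
caterpillar-isTree n = record
  { finite    = _ , +↔⊎
  ; connected = λ u v → walk-trans (to-root u) (walk-sym (to-root v))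
  ; acyclic   = bridges⇒acyclic caterpillar-bridge
  }
  where
  spine-to-root : ∀ x → Walk (caterpillar n) (inj₁ x) (inj₁ zero)
  spine-to-root = <-weakInduction _ (stop refl) λ i → step (inj₁ i) (inj₂ (refl , refl))
  to-root : ∀ u → Walk (caterpillar n) u (inj₁ zero)
  to-root (inj₁ x) = spine-to-root x
  to-root (inj₂ p) = step (inj₂ p) (inj₂ (refl , refl)) (spine-to-root (attach p))

tree-isStable : n ≢ 0 → (w : Word n) → No212 w → IsStableTree (tree w)
tree-isStable {n} n≢0 w avoid = record
  { isTree          = caterpillar-isTree n
  ; stable          = λ where
      (inj₁ x) _     → spine-degree n≢0 x
      (inj₂ p) ¬leaf → contradiction (leaf-isLeaf p) ¬leaf
  ; label-cong      = cong _
  ; leaf⇒labelled   = λ where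
      (inj₁ x) isLeaf → contradiction isLeaf (spine-notLeaf n≢0 x)
      (inj₂ p) _      → leaf-labelled w avoid p
  ; labelled⇒leaf   = λ { {inj₂ p} _ → leaf-isLeaf p }
  ; label-bijective = λ x → let p , label≡ = leaf-exists w avoid x in
      inj₂ p , label≡ , λ { {inj₂ q} label≡′ →
        cong inj₂ (leaf-unique w avoid p q (trans label≡ (sym label≡′))) }
  }

------------------------------------------------------------------------
-- Contractions of the caterpillar

-- The caterpillar with a list S of spine edges contracted.
module Contracted {n} (S : List (Edges n)) (spine-only : ∀ p → inj₂ p ∉ S) where
  T′ : Graph
  T′ = contract (caterpillar n) S

  open Graph T′ using (_≈_; _≉_; Joins; IsInternal; IsLeaf; Adjacent; Incident) public
  open Setoid (Graph.vertices T′) using ()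
    renaming (sym to ≈-sym; trans to ≈-trans; refl to ≈-refl; reflexive to ≈-reflexive) public

  V = Vertices n

  open DecMembership (≡-dec (_≟_ {n}) (_≟_ {suc (suc (suc n))})) using (_∈?_) public

  -- A relevant proof, recovered from the irrelevant one by decidability.
  unlabelled : (e : Graph.Edge T′) → value e ∉ S
  unlabelled (e , [ e∉S ]) with e ∈? S
  ... | yes e∈S = ⊥-elim-irr (e∉S e∈S)
  ... | no  e∉S = e∉S

  -- The edge at the leaf in position p.
  pendant : Fin (suc (suc (suc n))) → Graph.Edge T′
  pendant p = inj₂ p , [ spine-only p ]

  bridge-at : (e : Edges n) (e∉S : e ∉ S) → Bridge T′ (e , [ e∉S ])
  bridge-at e = contract-bridge (caterpillar-bridge e) S

  -- An edge that is not contracted still separates the spine.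
  cut : ∀ {i u v} → inj₁ i ∉ S → u ≈ v → toℕ i < depth u → toℕ i < depth v
  cut {i} {u} {v} i∉S u≈v i<u with toℕ i ℕₚ.<? depth v | Bridge.cong-≈ (bridge-at (inj₁ i) i∉S) u≈v
  ... | yes i<v | _  = i<v
  ... | no  i≮v | eq = case trans (sym (dec-true (toℕ i ℕₚ.<? depth u) i<u))
                                  (trans eq (dec-false (toℕ i ℕₚ.<? depth v) i≮v)) of λ ()

  ≈-leaf : ∀ {u p} → u ≈ inj₂ p → u ≡ inj₂ p
  ≈-leaf {u} {p} u≈p with u ≟ⱽ inj₂ p | Bridge.cong-≈ (bridge-at (inj₂ p) (spine-only p)) u≈p
  ... | yes u≡p | _  = u≡p
  ... | no  _   | eq = case trans eq (dec-true (inj₂ p ≟ⱽ inj₂ p) refl) of λ ()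

  contracted : ∀ i → inj₁ i ∈ S → inj₁ (inject₁ i) ≈ inj₁ (suc i)
  contracted i i∈S = Equivalence.return (inj₂ (inj₁ i , i∈S , inj₁ (refl , refl)))

  -- Spine vertices joined by contracted edges become equal.
  merged : ∀ {x y : Fin (suc n)} → toℕ x ≤ toℕ y → (∀ i → toℕ x ≤ toℕ i → toℕ i < toℕ y → inj₁ i ∈ S) →
           inj₁ x ≈ inj₁ y
  merged {x} {y} x≤y ∈S = go (toℕ y ∸ toℕ x) y (sym (m∸n+n≡m x≤y)) ∈S
    where
    go : ∀ d (y : Fin (suc n)) → toℕ y ≡ d + toℕ x → (∀ i → toℕ x ≤ toℕ i → toℕ i < toℕ y → inj₁ i ∈ S) →
         inj₁ x ≈ inj₁ y
    go zero    y       eq ∈S = ≈-reflexive (cong inj₁ (toℕ-injective (sym eq)))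
    go (suc d) (suc i) eq ∈S = ≈-trans
      (go d (inject₁ i) (trans (toℕ-inject₁ i) i≡) λ j x≤j j<i →
        ∈S j x≤j (m<n⇒m<1+n (subst (toℕ j <_) (toℕ-inject₁ i) j<i)))
      (contracted i (∈S i (subst (toℕ x ≤_) (sym i≡) (m≤n+m _ d)) (n<1+n _)))
      where
      i≡ : toℕ i ≡ d + toℕ x
      i≡ = suc-injective eq

  pendant-incident : ∀ {p e} → Incident (inj₂ p) e → e ≡ pendant p
  pendant-incident {p} {inj₁ i , _} (inj₁ s≈) = case ≈-leaf {p = p} s≈ of λ ()
  pendant-incident {p} {inj₁ i , _} (inj₂ t≈) = case ≈-leaf {p = p} t≈ of λ ()
  pendant-incident {p} {inj₂ q , _} (inj₁ s≈) = case ≈-leaf {p = p} s≈ of λ ()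
  pendant-incident {p} {inj₂ q , _} (inj₂ t≈) = case ≈-leaf {p = p} t≈ of λ { refl → refl }

  leaf-adjacent : ∀ {p v} → Adjacent (inj₂ p) v → inj₁ (attach p) ≈ v
  leaf-adjacent {p} (e , inj₁ (s≈p , t≈v)) with refl ← pendant-incident {e = e} (inj₁ s≈p) =
    case ≈-leaf {p = p} s≈p of λ ()
  leaf-adjacent {p} (e , inj₂ (s≈v , t≈p)) with refl ← pendant-incident {e = e} (inj₂ t≈p) = s≈v

  leaf-isLeaf′ : ∀ p → IsLeaf (inj₂ p)
  leaf-isLeaf′ p = pendant p , inj₂ ≈-refl , λ inc → sym (pendant-incident inc)

  -- Each end of a remaining spine edge also meets a leaf edge.
  spine-edge-internal : ∀ i (i∉S : inj₁ i ∉ S) → IsInternal (inj₁ i , [ i∉S ])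
  spine-edge-internal i i∉S =
    not-leaf (inject₁ i) (inj₁ ≈-refl) , not-leaf (suc i) (inj₂ ≈-refl)
    where
    not-leaf : ∀ x → Incident (inj₁ x) (inj₁ i , [ i∉S ]) → ¬ IsLeaf (inj₁ x)
    not-leaf x inc (e , _ , unique)
      with trans (sym (unique {inj₁ i , [ i∉S ]} inc))
             (unique {pendant (suc (inject₁ x))} (inj₁ (≈-reflexive (cong inj₁ (attach-inject₁ x)))))
    ... | ()

  -- The edge labeled in a step lies between leaf p and the root, and all
  -- spine edges between it and the leaf are contracted.  The edge touches
  -- the block of the leaf; it does not lead away from the root, since a
  -- path to leaf a crossing it could not return.
  step-sound : ∀ {u v vℓ v′ p} (π : Walk T′ u v) (e : Graph.Edge T′) → u ≡ inj₂ p → v ≡ inj₂ zero →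
    IsPath π → e ∈ edges π → IsInternal e → Adjacent u vℓ → Joins e vℓ v′ →
    ∃ λ i → value e ≡ inj₁ i × suc (toℕ i) < toℕ p ×
            (∀ j → i Fin.< j → suc (toℕ j) < toℕ p → inj₁ j ∈ S)
  step-sound π (inj₂ q , _) _ _ _ _ (_ , ¬leaf) _ _ = contradiction (leaf-isLeaf′ q) ¬leaf
  step-sound {p = p} π e@(inj₁ i , _) refl refl isPath e∈ int adj joins =
    i , refl , <attach⇒ i p (proj₁ (i<p×attached joins)) , between
    where
    i∉S : inj₁ i ∉ S
    i∉S = unlabelled e

    i<p×attached : ∀ {v′} → Joins e _ v′ → toℕ i < toℕ (attach p) × inj₁ (suc i) ≈ inj₁ (attach p)
    i<p×attached j with toℕ i ℕₚ.<? toℕ (attach p) | j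
    ... | yes i<p | inj₂ (_ , t≈vℓ) = i<p , ≈-trans t≈vℓ (≈-sym (leaf-adjacent adj))
    ... | yes i<p | inj₁ (s≈vℓ , _) =
      contradiction
        (subst (toℕ i <_) (toℕ-inject₁ i) (cut i∉S (≈-trans (leaf-adjacent adj) (≈-sym s≈vℓ)) i<p))
        (<-irrefl refl)
    ... | no  i≮p | _ = contradiction e∈
      (no-return (bridge-at (inj₁ i) i∉S) π isPath (dec-false (toℕ i ℕₚ.<? _) i≮p) refl)

    between : ∀ j → i Fin.< j → suc (toℕ j) < toℕ p → inj₁ j ∈ S
    between j i<j j<p with inj₁ j ∈? S
    ... | yes j∈S = j∈S
    ... | no  j∉S = contradiction i<j
      (<⇒≱ (cut j∉S (≈-sym (proj₂ (i<p×attached joins))) (<attach⇐ j p j<p)))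

  -- A walk from u, equal to spine vertex x, toward the root as far as spine
  -- vertex t and on to the leaf q.  Any property of u, of the spine vertices
  -- from t to x and of the leaf holds at all vertices visited, and the walk is
  -- a path if leaf q is not deeper than t.
  record Descent-to (u : V) (x t : Fin (suc n)) (q : Fin (suc (suc (suc n)))) : Set₁ where
    field
      walk       : Walk T′ u (inj₂ q)
      visits     : (Q : V → Set) → Q u → (∀ y → toℕ t ≤ toℕ y → toℕ y ≤ toℕ x → Q (inj₁ y)) →
                   Q (inj₂ q) → All Q (visited walk)
      walk-path  : toℕ (attach q) ≤ toℕ t → IsPath walk

  descend : ∀ {u} x t q → toℕ t ≤ toℕ x → u ≈ inj₁ x → inj₁ t ≈ inj₁ (attach q) → Descent-to u x t q
  descend x t q t≤x u≈x t≈q = go (toℕ x ∸ toℕ t) x (sym (m∸n+n≡m t≤x)) u≈x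
    where
    i≤1+i : (i : Fin n) → toℕ (inject₁ i) ≤ suc (toℕ i)
    i≤1+i i = ≤-trans (≤-reflexive (toℕ-inject₁ i)) (n≤1+n _)

    go : ∀ d {u} (x : Fin (suc n)) → toℕ x ≡ d + toℕ t → u ≈ inj₁ x → Descent-to u x t q
    go zero {u} x eq u≈x with refl ← toℕ-injective eq = record
      { walk      = step (pendant q) (inj₁ (≈-trans (≈-sym t≈q) (≈-sym u≈x) , ≈-refl)) (stop ≈-refl)
      ; visits    = λ Q Qu _ Qq → Qu ∷ Qq ∷ []
      ; walk-path = λ _ → ((λ u≈q → case ≈-leaf (≈-trans (≈-sym u≈x) u≈q) of λ ()) ∷ []) ∷ [] ∷ []
      }
    go (suc d) {u} (suc i) eq u≈x with inj₁ i ∈? S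
    ... | yes i∈S = record
      { walk      = walk
      ; visits    = λ Q Qu Qx Qq → visits Q Qu (λ y t≤y y≤i → Qx y t≤y (≤-trans y≤i (i≤1+i i))) Qq
      ; walk-path = walk-path
      }
      where
      open Descent-to (go d (inject₁ i) (trans (toℕ-inject₁ i) (suc-injective eq))
                         (≈-trans u≈x (≈-sym (contracted i i∈S))))
    ... | no i∉S = record
      { walk      = step (inj₁ i , [ i∉S ]) (inj₂ (≈-refl , ≈-sym u≈x)) walk
      ; visits    = λ Q Qu Qx Qq → Qu ∷ visits Q (Qx (inject₁ i) t≤inject₁i (i≤1+i i))
                      (λ y t≤y y≤i → Qx y t≤y (≤-trans y≤i (i≤1+i i))) Qq
      ; walk-path = λ q≤t → All.map (λ i≮z u≈z → i≮z (cut i∉S (≈-trans (≈-sym u≈x) u≈z) (n<1+n _)))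
          (visits (λ z → ¬ toℕ i < depth z) (<-irrefl refl ∘ subst (toℕ i <_) (toℕ-inject₁ i))
            (λ y _ y≤i → <-irrefl refl ∘ (λ i<y → <-≤-trans i<y (subst (toℕ y ≤_) (toℕ-inject₁ i) y≤i)))
            (λ i<q → <-irrefl refl (<-≤-trans i<q (≤-trans q≤t (subst (toℕ t ≤_) (sym i≡) (m≤n+m _ d))))))
          ∷ walk-path q≤t
      }
      where
      i≡ : toℕ i ≡ d + toℕ t
      i≡ = suc-injective eq
      t≤inject₁i : toℕ t ≤ toℕ (inject₁ i)
      t≤inject₁i = subst (toℕ t ≤_) (sym (trans (toℕ-inject₁ i) i≡)) (m≤n+m _ d)
      open Descent-to (go d (inject₁ i) (trans (toℕ-inject₁ i) i≡) ≈-refl)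

smallest : ∀ {N} {P : Fin N → Set} → (∀ x → Dec (P x)) → ∃ P → ∃ λ m → P m × (∀ x → P x → m Fin.≤ x)
smallest {suc N} {P} P? (y , Py) with P? zero
... | yes p₀ = zero , p₀ , λ _ _ → z≤n
... | no ¬p₀ with y
... | zero  = contradiction Py ¬p₀
... | suc y with smallest (P? ∘ suc) (y , Py)
... | m , Pm , m≤ = suc m , Pm , λ { zero p₀ → contradiction p₀ ¬p₀ ; (suc x) Px → s≤s (m≤ x Px) }

-- The position of each label, when the labels form a bijection.
module Positions {n} (w : Word n) (avoid : No212 w) where

  position : Label n → Fin (suc (suc (suc n)))
  position x = proj₁ (leaf-exists w avoid x)

  position-label : ∀ x → lookup (leafLabels w) (position x) ≡ just x
  position-label x = proj₂ (leaf-exists w avoid x)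

  -- The depth of the leaf with a given label.
  level : Label n → ℕ
  level x = toℕ (attach (position x))

  position-unique : ∀ {p x} → lookup (leafLabels w) p ≡ just x → position x ≡ p
  position-unique {p} {x} eq = leaf-unique w avoid _ p (trans (position-label x) (sym eq))

  position-injective : ∀ {x y} → position x ≡ position y → x ≡ y
  position-injective {x} {y} eq = just-injective
    (trans (sym (position-label x)) (trans (cong (lookup (leafLabels w)) eq) (position-label y)))

-- A step of the labeling in the tree of w: under the hypotheses below the
-- edge i may receive the letter ℓ.  The labels outside the branches of a
-- and ℓ are those beyond i other than ℓ, at the far end of i, and those in
-- the block of i other than a, at the near end.
module StepComplete {n} (n≢0 : n ≢ 0) (w : Word n) (avoid : No212 w)
                    (S : List (Edges n)) (spine-only : ∀ p → inj₂ p ∉ S) where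
  open Contracted S spine-only
  open Positions w avoid

  attach-a : attach (position a) ≡ zero
  attach-a = cong attach (position-unique {zero} refl)

  a-attached : inj₁ zero ≈ inj₁ (attach (position a))
  a-attached = ≈-reflexive (cong inj₁ (sym attach-a))

  -- Edge i is the first remaining one from leaf ℓ to the root, and x₀ is a
  -- label in the block at its near end which is at most all labels beyond i
  -- other than ℓ.  Then so is the least label of that block.
  module _ (ℓ i : Fin n) (i∉S : inj₁ i ∉ S) (i<ℓ : toℕ i < level (num ℓ))
           (between : ∀ j → i Fin.< j → toℕ j < level (num ℓ) → inj₁ j ∈ S)
           (x₀ : Label n) (x₀≢a : x₀ ≢ a) (x₀≤i : level x₀ ≤ toℕ i)
           (x₀-block : ∀ j → level x₀ ≤ toℕ j → j Fin.< i → inj₁ j ∈ S)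
           (x₀-small : ∀ y → toℕ i < level y → y ≢ num ℓ → x₀ Fin.≤ y) where

    leaf : Label n → V
    leaf x = inj₂ (position x)

    -- The far and the near end of edge i.
    vℓ v : V
    vℓ = inj₁ (suc i)
    v  = inj₁ (inject₁ i)

    ℓ-attached : vℓ ≈ inj₁ (attach (position (num ℓ)))
    ℓ-attached = merged i<ℓ (λ j i<j j<ℓ → between j i<j j<ℓ)

    -- The label x lies in a branch at u containing neither a nor ℓ.
    Other : V → Label n → Set
    Other u x = ¬ SameBranch T′ u (leaf x) (leaf a) × ¬ SameBranch T′ u (leaf x) (leaf (num ℓ))

    branch-refl : ∀ {u x} → leaf x ≉ u → SameBranch T′ u (leaf x) (leaf x)
    branch-refl x≉ = stop ≈-refl , x≉ ∷ []

    leaf≉spine : ∀ x y → leaf x ≉ inj₁ y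
    leaf≉spine x y eq = case ≈-leaf (≈-sym eq) of λ ()

    -- A branch at u contains both leaves x and y if u is not met on the way
    -- from x toward the root down to spine vertex t, next to leaf y.
    down : ∀ x t y → toℕ t ≤ level x → inj₁ t ≈ inj₁ (attach (position y)) → (u : V) →
           leaf x ≉ u → (∀ z → toℕ t ≤ toℕ z → toℕ z ≤ level x → inj₁ z ≉ u) → leaf y ≉ u →
           SameBranch T′ u (leaf x) (leaf y)
    down x t y t≤x t≈y u x≉u z≉u y≉u =
      step (pendant (position x)) (inj₂ (≈-refl , ≈-refl)) walk ,
      x≉u ∷ visits (_≉ u) (z≉u _ t≤x ≤-refl) z≉u y≉u
      where open Descent-to (descend (attach (position x)) t (position y) t≤x ≈-refl t≈y)

    -- A walk with exactly one end at a leaf visits the neighbor of that leaf.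
    visits-neighbour : ∀ {p u z} (π : Walk T′ u z) → (u ≡ inj₂ p → z ≢ inj₂ p) → (u ≢ inj₂ p → z ≡ inj₂ p) →
                       ∀ {y} → inj₁ (attach p) ≈ y → ¬ All (_≉ y) (visited π)
    visits-neighbour {p} {u} {z} π h₁ h₂ {y} p≈y all = All.lookupWith (λ z≉y z≈ → z≉y (≈-trans z≈ p≈y)) all
      (proj₁ (proj₂ (crossing (bridge-at (inj₂ p) (spine-only p)) π differ)))
      where
      differ : does (u ≟ⱽ inj₂ p) ≢ does (z ≟ⱽ inj₂ p)
      differ with u ≟ⱽ inj₂ p | z ≟ⱽ inj₂ p
      ... | yes eq | yes eq′ = contradiction eq′ (h₁ eq)
      ... | no ≢   | no ≢′   = contradiction (h₂ ≢) ≢′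
      ... | yes _  | no _    = λ ()
      ... | no _   | yes _   = λ ()

    i≮a : ¬ toℕ i < level a
    i≮a lt = case subst (toℕ i <_) (cong toℕ attach-a) lt of λ ()

    other-vℓ : ∀ {x} → toℕ i < level x → x ≢ num ℓ → Other vℓ x
    other-vℓ {x} i<x x≢ℓ =
      (λ (π , avoids) → All.lookupWith (λ z≉ z≈ → z≉ z≈) avoids
        (proj₂ (proj₂ (crossing (bridge-at (inj₁ i) i∉S) π λ eq →
          case trans (sym (dec-true (toℕ i ℕₚ.<? level x) i<x))
                     (trans eq (dec-false (toℕ i ℕₚ.<? level a) i≮a)) of λ ())))) ,
      (λ (π , avoids) → visits-neighbour π (λ eq _ → x≢ℓ (position-injective (inj₂-injective eq))) (λ _ → refl)
                          (≈-sym ℓ-attached) avoids)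

    other-vℓ⁻ : ∀ {x} → Other vℓ x → toℕ i < level x × x ≢ num ℓ
    other-vℓ⁻ {x} (¬a , ¬ℓ) with toℕ i ℕₚ.<? level x | x ≟ num ℓ
    ... | _       | yes refl = contradiction (branch-refl (leaf≉spine x (suc i))) ¬ℓ
    ... | yes i<x | no x≢ℓ   = i<x , x≢ℓ
    ... | no  i≮x | no _     = contradiction (down x zero a z≤n a-attached vℓ (leaf≉spine x (suc i))
        (λ z _ z≤x z≈ → i≮x (<-≤-trans (cut i∉S (≈-sym z≈) (n<1+n _)) z≤x)) (leaf≉spine a (suc i))) ¬a

    other-vℓ? : ∀ x → Dec (Other vℓ x)
    other-vℓ? x = map′ (λ (i<x , x≢ℓ) → other-vℓ i<x x≢ℓ) other-vℓ⁻
                       ((toℕ i ℕₚ.<? level x) ×-dec ¬? (x ≟ num ℓ))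

    other-v : ∀ {x} → x ≢ a → level x ≤ toℕ i → (∀ j → level x ≤ toℕ j → j Fin.< i → inj₁ j ∈ S) → Other v x
    other-v {x} x≢a x≤i block =
      (λ (π , avoids) → visits-neighbour π (λ _ eq → x≢a (position-injective (sym (inj₂-injective eq))))
                          (contradiction refl) attached avoids) ,
      (λ (π , avoids) → visits-neighbour π (λ _ eq → x≢ℓ (position-injective (sym (inj₂-injective eq))))
                          (contradiction refl) attached avoids)
      where
      x≢ℓ : x ≢ num ℓ
      x≢ℓ refl = <⇒≱ i<ℓ x≤i
      attached : inj₁ (attach (position x)) ≈ v
      attached = merged (≤-trans x≤i (≤-reflexive (sym (toℕ-inject₁ i))))
        (λ j x≤j j<i → block j x≤j (subst (toℕ j <_) (toℕ-inject₁ i) j<i))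

    other-v? : ∀ x → Dec (Other v x)
    other-v? x with x ≟ a | toℕ i ℕₚ.<? level x
       | Finₚ.any? (λ j → (level x ℕₚ.≤? toℕ j) ×-dec (j Finₚ.<? i) ×-dec ¬? (inj₁ j ∈? S))
    ... | yes refl | _ | _ = no λ (¬a , _) → ¬a (branch-refl (leaf≉spine x _))
    ... | no _ | yes i<x | _ = no λ (_ , ¬ℓ) → ¬ℓ (down x (suc i) (num ℓ) i<x ℓ-attached v (leaf≉spine x _)
        (λ z i<z _ z≈ → <-irrefl (sym (toℕ-inject₁ i)) (cut i∉S z≈ i<z)) (leaf≉spine (num ℓ) _))
    ... | no _ | no _ | yes (j , x≤j , j<i , j∉S) = no λ (¬a , _) →
        ¬a (down x zero a z≤n a-attached v (leaf≉spine x _)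
        (λ z _ z≤x z≈ → <⇒≱ (cut j∉S (≈-sym z≈) (subst (toℕ j <_) (sym (toℕ-inject₁ i)) j<i))
                            (≤-trans z≤x x≤j))
        (leaf≉spine a _))
    ... | no x≢a | no i≮x | no unseparated = yes (other-v x≢a (≮⇒≥ i≮x) block)
      where
      block : ∀ j → level x ≤ toℕ j → j Fin.< i → inj₁ j ∈ S
      block j x≤j j<i with inj₁ j ∈? S
      ... | yes j∈S = j∈S
      ... | no  j∉S = contradiction (j , x≤j , j<i , j∉S) unseparated

    i<n : ∀ {x} p → lookup (leafLabels w) p ≡ just x → attach p ≡ fromℕ n → toℕ i < level x
    i<n {x} p eq p≡ = subst (toℕ i <_)
      (sym (trans (cong toℕ (trans (cong attach (position-unique {p} eq)) p≡)) (Finₚ.toℕ-fromℕ n))) (toℕ<n i)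

    -- One of the two rightmost leaves is not ℓ.
    right-exists : ∃ (Other vℓ)
    right-exists
      with leaf-labelled w avoid (suc (fromℕ (suc n))) | leaf-labelled w avoid (suc (inject₁ (fromℕ n)))
    ... | x₁ , eq₁ | x₂ , eq₂ with x₁ ≟ num ℓ
    ... | no x₁≢ℓ  = x₁ , other-vℓ (i<n (suc (fromℕ (suc n))) eq₁ attach-last) x₁≢ℓ
    ... | yes refl = x₂ , other-vℓ (i<n (suc (inject₁ (fromℕ n))) eq₂ (attach-inject₁ (fromℕ n))) x₂≢ℓ
      where
      x₂≢ℓ : x₂ ≢ num ℓ
      x₂≢ℓ refl = Finₚ.fromℕ≢inject₁ (Finₚ.suc-injective
        (leaf-unique w avoid (suc (fromℕ (suc n))) (suc (inject₁ (fromℕ n))) (trans eq₁ (sym eq₂))))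

    slide-step : SlideStep (tree-isStable n≢0 w avoid) ℓ S (inj₁ i , [ i∉S ])
    slide-step = record
      { path        = step (pendant (position (num ℓ))) (inj₂ (≈-sym ℓ-attached , ≈-refl))
                        (step (inj₁ i , [ i∉S ]) (inj₂ (≈-refl , ≈-refl)) walk)
      ; isPath      = (leaf≉ ∷ All.map (λ z≢ ℓ≈z → z≢ (≈-leaf (≈-sym ℓ≈z)))
                          (visits (_≢ leaf (num ℓ)) (λ ()) (λ _ _ _ ()) a≢ℓ))
                      ∷ All.map (λ i≮z i≈z → i≮z (cut i∉S i≈z (n<1+n _)))
                          (visits (λ z → ¬ toℕ i < depth z) (λ lt → <-irrefl (sym (toℕ-inject₁ i)) lt)
                             (λ z _ z≤i i<z → <-irrefl refl
                               (<-≤-trans i<z (subst (toℕ z ≤_) (toℕ-inject₁ i) z≤i))) i≮a)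
                      ∷ walk-path (≤-reflexive (cong toℕ attach-a))
      ; first       = pendant (position (num ℓ)) ∷ [] , edges walk , refl ,
                      (λ (_ , ¬leaf) → ¬leaf (leaf-isLeaf′ (position (num ℓ)))) ∷ [] ,
                      spine-edge-internal i i∉S
      ; vℓ          = vℓ
      ; v           = v
      ; vℓ-adjacent = pendant (position (num ℓ)) , inj₂ (≈-sym ℓ-attached , ≈-refl)
      ; e-joins     = inj₂ (≈-refl , ≈-refl)
      ; mℓ          = proj₁ right
      ; ma          = proj₁ left
      ; mℓ-smallest = proj₂ right
      ; ma-smallest = proj₂ left
      ; ma≤mℓ       = ≤-trans (proj₂ (proj₂ left) x₀ x₀-other)
                        (let i<m , m≢ℓ = other-vℓ⁻ (proj₁ (proj₂ right)) in x₀-small _ i<m m≢ℓ)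
      }
      where
      open Descent-to (descend (inject₁ i) zero (position a) z≤n ≈-refl a-attached)
      right = smallest other-vℓ? right-exists
      x₀-other = other-v x₀≢a x₀≤i x₀-block
      left = smallest other-v? (x₀ , x₀-other)
      leaf≉ : leaf (num ℓ) ≉ vℓ
      leaf≉ = leaf≉spine (num ℓ) (suc i)
      a≢ℓ : leaf a ≢ leaf (num ℓ)
      a≢ℓ eq = case position-injective (inj₂-injective eq) of λ ()

------------------------------------------------------------------------
-- Lists

AllPairs-reverse : ∀ {A : Set} {R : A → A → Set} {xs : List A} →
  AllPairs R xs → AllPairs (λ x y → R y x) (reverse xs)
AllPairs-reverse {xs = []}     []         = []
AllPairs-reverse {xs = x ∷ xs} (px ∷ pxs) = subst (AllPairs _) (sym (unfold-reverse x xs))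
  (AllPairsₚ.++⁺ (AllPairs-reverse pxs) ([] ∷ [])
    (All.tabulate λ y∈ → All.lookup px (Anyₚ.reverse⁻ y∈) ∷ []))

descending : ∀ n → AllPairs Fin._>_ (reverse (allFin n))
descending n = AllPairs-reverse (AllPairsₚ.tabulate⁺-< id)

AllPairs-concatMap : ∀ {A B : Set} {R : A → A → Set} {S : B → B → Set} (f : A → List B)
  {xs : List A} → AllPairs R xs → (∀ x → AllPairs S (f x)) → (∀ {x y} → R x y → ∀ {u v} → u ∈ f x → v ∈ f y → S u v) →
  AllPairs S (concatMap f xs)
AllPairs-concatMap f xs! within across = AllPairsₚ.concat⁺ (Allₚ.map⁺ (All.tabulate λ {x} _ → within x))
  (AllPairsₚ.map⁺ (AllPairs.map (λ Rxy → All.tabulate λ u∈ → All.tabulate λ v∈ → across Rxy u∈ v∈) xs!))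

-- Positions holding the letter ℓ spell a power of ℓ.
map-filter-≟ : ∀ {A : Set} (f : A → Fin n) ℓ (xs : List A) →
  map f (filter (λ x → ℓ ≟ f x) xs) ≡ replicate (length (filter (λ x → ℓ ≟ f x) xs)) ℓ
map-filter-≟ f ℓ []       = refl
map-filter-≟ f ℓ (x ∷ xs) with ℓ ≟ f x
... | yes refl = cong (ℓ ∷_) (map-filter-≟ f ℓ xs)
... | no _     = map-filter-≟ f ℓ xs

filter-tabulate : ∀ {m} {A : Set} (g : A → Fin n) ℓ (f : Fin m → A) →
  length (filter (λ x → ℓ ≟ g x) (List.tabulate f)) ≡ Vec.count (ℓ ≟_) (Vec.tabulate (g ∘ f))
filter-tabulate {m = zero}  g ℓ f = refl
filter-tabulate {m = suc m} g ℓ f with does (ℓ ≟ g (f zero))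
... | true  = cong suc (filter-tabulate g ℓ (f ∘ suc))
... | false = filter-tabulate g ℓ (f ∘ suc)

-- The largest j below i with a decidable property, if there is one.
last-before : ∀ {m} {Q : Fin m → Set} → (∀ j → Dec (Q j)) → ∀ (i : Fin m) →
  (∀ j → j Fin.< i → ¬ Q j) ⊎ ∃ λ j → j Fin.< i × Q j × (∀ j′ → j Fin.< j′ → j′ Fin.< i → ¬ Q j′)
last-before Q? zero    = inj₁ λ _ ()
last-before Q? (suc i) with last-before (Q? ∘ suc) i
... | inj₂ (j , j<i , Qj , none) = inj₂ (suc j , s<s j<i , Qj ,
    λ { (suc j′) j<j′ j′<i → none j′ (s<s⁻¹ j<j′) (s<s⁻¹ j′<i) })
... | inj₁ none with Q? zero
... | yes q₀ = inj₂ (zero , z<s , q₀ , λ { (suc j′) _ j′<i → none j′ (s<s⁻¹ j′<i) })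
... | no ¬q₀ = inj₁ λ { zero _ → ¬q₀ ; (suc j) j<i → none j (s<s⁻¹ j<i) }

------------------------------------------------------------------------
-- Walks along the spine

-- The walk from spine vertex x to the end of the spine, where m edges
-- remain, with what an edge word requires of it.
record Ascent {n} (m : ℕ) (x : Fin (suc n)) : Set₁ where
  field
    walk     : Walk (caterpillar n) (inj₁ x) (inj₁ (fromℕ n))
    rising   : All (λ z → toℕ x ≤ depth z) (visited walk)
    isPath   : IsPath walk
    spine    : All (λ e → ∃ λ i → e ≡ inj₁ i) (edges walk)
    complete : ∀ i → toℕ x ≤ toℕ i → inj₁ i ∈ edges walk
    reads    : ∀ {R : Edges n → Fin n → Set} (ws : Vec (Fin n) m) →
               (∀ s i → toℕ i ≡ toℕ s + toℕ x → R (inj₁ i) (lookup ws s)) → Pointwise R (edges walk) (toList ws)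

ascend : ∀ m (x : Fin (suc n)) → m + toℕ x ≡ n → Ascent m x
ascend {n} zero x x≡n with refl ← toℕ-injective {i = x} {fromℕ n} (trans x≡n (sym (Finₚ.toℕ-fromℕ n))) = record
  { walk     = stop refl
  ; rising   = ≤-refl ∷ []
  ; isPath   = [] ∷ []
  ; spine    = []
  ; complete = λ i n≤i → contradiction (toℕ<n i) (≤⇒≯ (subst (_≤ toℕ i) (Finₚ.toℕ-fromℕ n) n≤i))
  ; reads    = λ { [] _ → [] }
  }
ascend {n} (suc m) x m+x≡n = record
  { walk     = step (inj₁ i) (inj₁ (cong inj₁ (sym x≡) , refl)) walk
  ; rising   = ≤-refl ∷ All.map (≤-trans x≤1+i) rising
  ; isPath   = All.map (λ { i<z refl → <-irrefl i≡ i<z }) rising ∷ isPath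
  ; spine    = (i , refl) ∷ spine
  ; complete = λ j x≤j → case ℕₚ.m≤n⇒m<n∨m≡n x≤j of λ where
      (inj₁ x<j) → there (complete j (subst (_< toℕ j) (sym i≡) x<j))
      (inj₂ x≡j) → here (cong inj₁ (toℕ-injective (sym (trans i≡ x≡j))))
  ; reads    = λ { (y ∷ ws) R → R zero i i≡ ∷ reads ws λ s j j≡ →
      R (suc s) j (trans j≡ (trans (cong (toℕ s +_) (cong suc i≡)) (+-suc _ _))) }
  }
  where
  x<n : toℕ x < n
  x<n = subst (suc (toℕ x) ≤_) m+x≡n (s≤s (m≤n+m _ m))
  i : Fin n
  i = fromℕ< x<n
  i≡ : toℕ i ≡ toℕ x
  i≡ = Finₚ.toℕ-fromℕ< x<n
  x≡ : x ≡ inject₁ i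
  x≡ = toℕ-injective (trans (sym i≡) (sym (toℕ-inject₁ i)))
  x≤1+i : toℕ x ≤ suc (toℕ i)
  x≤1+i = subst (λ t → toℕ x ≤ suc t) (sym i≡) (n≤1+n _)
  open Ascent (ascend m (suc i) (trans (cong (λ t → m + suc t) i≡) (trans (+-suc m _) m+x≡n)))

-- A path along internal edges that starts at spine vertex x, and does not
-- meet the vertices before x, can only go outward.
read-spine : ∀ {m} (x : Fin (suc n)) {v} (π : Walk (caterpillar n) (inj₁ x) v) → IsPath π →
  (∀ y → y Fin.< x → All (_≢ inj₁ y) (visited π)) → All (Graph.IsInternal (caterpillar n)) (edges π) →
  ∀ {R : Edges n → Fin n → Set} (ws : Vec (Fin n) m) → Pointwise R (edges π) (toList ws) →
  ∀ s i → toℕ i ≡ toℕ s + toℕ x → R (inj₁ i) (lookup ws s)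
read-spine x (stop _) _ _ _ []       [] ()
read-spine x (stop _) _ _ _ (_ ∷ _)  () _
read-spine x (step (inj₂ p) _ π) _ _ ((_ , ¬leaf) ∷ _) _ _ = contradiction (leaf-isLeaf p) ¬leaf
read-spine x (step (inj₁ j) (inj₂ (refl , refl)) π) (_ ∷ _) rising _ _ _ =
  contradiction refl (All.lookup (All.tail (rising (inject₁ j) (s≤s (≤-reflexive (toℕ-inject₁ j))))) (start∈ π))
  where
  start∈ : ∀ {u v} (π : Walk (caterpillar _) u v) → u ∈ visited π
  start∈ (stop _)     = here refl
  start∈ (step _ _ _) = here refl
read-spine x (step (inj₁ j) (inj₁ (refl , refl)) π) (x∉ ∷ π!) rising (_ ∷ int) {R} (y ∷ ws)
           (Re ∷ Res) zero i i≡ =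
  subst (λ j → R (inj₁ j) y) (toℕ-injective (sym (trans i≡ (toℕ-inject₁ j)))) Re
read-spine x (step (inj₁ j) (inj₁ (refl , refl)) π) (x∉ ∷ π!) rising (_ ∷ int) (y ∷ ws)
           (Re ∷ Res) (suc s) i i≡ =
  read-spine (suc j) π π! rising′ int ws Res s i
    (trans i≡ (trans (cong (λ t → suc (toℕ s + t)) (toℕ-inject₁ j)) (sym (+-suc _ _))))
  where
  rising′ : ∀ y → y Fin.< suc j → All (_≢ inj₁ y) (visited π)
  rising′ y y≤j with ℕₚ.m≤n⇒m<n∨m≡n (s≤s⁻¹ y≤j)
  ... | inj₁ y<j = All.tail (rising y (subst (toℕ y <_) (sym (toℕ-inject₁ j)) y<j))
  ... | inj₂ y≡j with refl ← toℕ-injective {i = y} {inject₁ j} (trans y≡j (sym (toℕ-inject₁ j))) =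
    All.map (λ ≢ eq → ≢ (sym eq)) x∉

-- Only the positions 2, 3, … carry a label other than a and b.
fill-position : (w : Word n) → ∀ p {x} → lookup (leafLabels w) p ≡ just (num x) →
  ∃ λ s → p ≡ suc (suc s) × lookup (fill (unusedLabels (toList w)) w) s ≡ just (num x)
fill-position w (suc (suc s)) eq = s , refl , eq

------------------------------------------------------------------------
-- Avoidance gives a slide labeling

-- An avoiding word and the slide labeling of its tree.
module Avoiding {n} (n≢0 : n ≢ 0) (w : Word n) (k : Vec ℕ n) (justified : RightJustified k)
                (content : HasContent w k) (no212 : Avoids-2-1-2 w) (no23 : Avoids-23-2̅-1 w) where
  open Positions w no212

  st : IsStableTree (tree w)
  st = tree-isStable n≢0 w no212

  good : AvoidingSupply (unusedLabels (toList w)) w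
  good = avoids⇒AvoidingSupply w k justified content no212 no23

  -- Condition (A), in terms of the depth of leaf w_i.
  own-label : ∀ i → toℕ i < level (num (lookup w i)) ×
              (∀ j → i Fin.< j → toℕ j < level (num (lookup w i)) → lookup w i Fin.≤ lookup w j)
  own-label i with position (num (lookup w i)) | position-label (num (lookup w i))
  ... | p | eq with fill-position w p eq
  ... | s , refl , fs with own-label-after w good i s fs
  ... | i≤s , after = <attach⇐ i p (s<s (s≤s i≤s)) ,
    λ j i<j j<p → after j i<j (s≤s⁻¹ (s<s⁻¹ (<attach⇒ j p j<p)))

  -- A label in the block at the near end of edge i, at the time when i is to
  -- be labeled, that is at most all labels beyond i.  With j the last edge
  -- before i whose letter is at most w_i, the block begins just after j, and
  -- its first leaf is a nondescent leaf; without such j it contains b.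
  block-leaf : ∀ i → ∃ λ x₀ → x₀ ≢ a × level x₀ ≤ toℕ i ×
    (∀ j → level x₀ ≤ toℕ j → j Fin.< i → lookup w i Fin.< lookup w j) ×
    (∀ y → toℕ i < level y → x₀ Fin.≤ y)
  block-leaf i with last-before (λ j → lookup w j Finₚ.≤? lookup w i) i
  ... | inj₁ none = b , (λ ()) , subst (_≤ toℕ i) (sym level-b) z≤n , (λ j _ j<i → ≰⇒> (none j j<i)) , b≤
    where
    level-b : level b ≡ 0
    level-b = cong (toℕ ∘ attach) (position-unique {suc zero} refl)
    level-a : level a ≡ 0
    level-a = cong (toℕ ∘ attach) (position-unique {zero} refl)
    b≤ : ∀ y → toℕ i < level y → 1 ≤ toℕ y
    b≤ zero    i<a = case subst (toℕ i <_) level-a i<a of λ ()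
    b≤ (suc y) _   = s≤s z≤n
  ... | inj₂ (j , j<i , wj≤wi , none) with leaf-labelled w no212 (suc (suc (inject₁ j)))
  ... | x₀ , label₀ = x₀ , x₀≢a , subst (_≤ toℕ i) (sym level-x₀) j<i ,
        (λ j′ j<j′ j′<i → ≰⇒> (none j′ (subst (_≤ toℕ j′) level-x₀ j<j′) j′<i)) , small
    where
    position≡ : position x₀ ≡ suc (suc (inject₁ j))
    position≡ = position-unique label₀
    level-x₀ : level x₀ ≡ suc (toℕ j)
    level-x₀ = cong toℕ (trans (cong attach position≡) (attach-inject₁ (suc j)))
    x₀≢a : x₀ ≢ a
    x₀≢a refl = case trans (sym position≡) (position-unique {zero} refl) of λ ()
    j⁺ : Fin n
    j⁺ = fromℕ< (≤-<-trans j<i (toℕ<n i))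
    j⁺≡ : toℕ j⁺ ≡ suc (toℕ j)
    j⁺≡ = Finₚ.toℕ-fromℕ< _
    nondescent : lookup w j Fin.≤ lookup w j⁺
    nondescent with ℕₚ.m≤n⇒m<n∨m≡n j<i
    ... | inj₂ eq = subst (λ z → lookup w j Fin.≤ lookup w z) (toℕ-injective (sym (trans j⁺≡ eq))) wj≤wi
    ... | inj₁ lt = ≤-trans wj≤wi (<⇒≤ (≰⇒> (none j⁺ (≤-reflexive (sym j⁺≡)) (subst (_< toℕ i) (sym j⁺≡) lt))))
    small : ∀ y → toℕ i < level y → x₀ Fin.≤ y
    small y i<y with position y | position-label y
    ... | p | eq with p | eq | <attach⇒ i p i<y
    ... | suc (suc s) | fs | s≤s (s≤s i≤s) =
      <⇒≤ (nondescent-increases w good j j⁺ s j⁺≡ nondescent (<-≤-trans j<i i≤s) label₀ fs)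

  -- Edge i is labeled before edge j: larger letters first, and equal letters
  -- from the leaves toward the root.
  _≺_ : Fin n → Fin n → Set
  i ≺ j = lookup w j Fin.< lookup w i ⊎ (lookup w i ≡ lookup w j × j Fin.< i)

  ≺-irrefl : ∀ {i} → ¬ i ≺ i
  ≺-irrefl (inj₁ lt)       = <-irrefl refl lt
  ≺-irrefl (inj₂ (_ , lt)) = <-irrefl refl lt

  ≺-asym : ∀ {i j} → i ≺ j → ¬ j ≺ i
  ≺-asym (inj₁ lt)        (inj₁ lt′)       = <-asym lt lt′
  ≺-asym (inj₁ lt)        (inj₂ (eq , _))  = <-irrefl (cong toℕ eq) lt
  ≺-asym (inj₂ (eq , _))  (inj₁ lt′)       = <-irrefl (cong toℕ eq) lt′
  ≺-asym (inj₂ (_ , lt))  (inj₂ (_ , lt′)) = <-asym lt lt′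

  -- The labeling of the edges in a list by their letters in w.
  labelled : List (Fin n) → EdgeLabeling st
  labelled = map (λ i → inj₁ i , lookup w i)

  edges-of : List (Fin n) → List (Edges n)
  edges-of is = map proj₁ (labelled is)

  ∈-edges⁺ : ∀ {i is} → i ∈ is → inj₁ i ∈ edges-of is
  ∈-edges⁺ i∈ = ∈-map⁺ proj₁ (∈-map⁺ (λ i → inj₁ i , lookup w i) i∈)

  ∈-edges⁻ : ∀ {e is} → e ∈ edges-of is → ∃ λ i → e ≡ inj₁ i × i ∈ is
  ∈-edges⁻ e∈ with ∈-map⁻ proj₁ e∈
  ... | _ , e∈′ , refl with ∈-map⁻ (λ i → inj₁ i , lookup w i) e∈′
  ... | i , i∈ , refl = i , refl , i∈

  -- When the edges is have been labeled, the edges js can be.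
  slides-from : ∀ is js → AllPairs _≺_ js → (∀ j → j ∈ is ⊎ j ∈ js) → (∀ {i j} → i ∈ is → j ∈ js → i ≺ j) →
    ∃ λ λs → Slides st (map (lookup w) js) (labelled is) λs × (∀ i → (inj₁ i , lookup w i) ∈ λs)
  slides-from is []       _           total _  =
    labelled is , done , λ i → ∈-map⁺ (λ i → inj₁ i , lookup w i) ([ id , (λ ()) ]′ (total i))
  slides-from is (i ∷ js) (i≺ ∷ js!) total is≺ =
    let λs , slides , ∈λs = slides-from (i ∷ is) js js! total′ is≺′ in
    λs , next (inj₁ i , [ i∉ ]) step-i slides , ∈λs
    where
    total′ : ∀ j → j ∈ i ∷ is ⊎ j ∈ js
    total′ j with total j
    ... | inj₁ j∈           = inj₁ (there j∈)
    ... | inj₂ (here refl)  = inj₁ (here refl)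
    ... | inj₂ (there j∈)   = inj₂ j∈
    is≺′ : ∀ {j j′} → j ∈ i ∷ is → j′ ∈ js → j ≺ j′
    is≺′ (here refl) j′∈ = All.lookup i≺ j′∈
    is≺′ (there j∈)  j′∈ = is≺ j∈ (there j′∈)
    i∉ : inj₁ i ∉ edges-of is
    i∉ i∈ with ∈-edges⁻ i∈
    ... | .i , refl , i∈is = ≺-irrefl (is≺ i∈is (here refl))
    done-before : ∀ {j} → j ≺ i → inj₁ j ∈ edges-of is
    done-before {j} j≺i with total j
    ... | inj₁ j∈          = ∈-edges⁺ j∈
    ... | inj₂ (here refl) = contradiction j≺i ≺-irrefl
    ... | inj₂ (there j∈)  = contradiction (All.lookup i≺ j∈) (≺-asym j≺i)
    step-i : SlideStep st (lookup w i) (edges-of is) (inj₁ i , [ i∉ ])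
    step-i with block-leaf i
    ... | x₀ , x₀≢a , x₀≤i , block , small = slide-step (lookup w i) i i∉ (proj₁ (own-label i))
        (λ j i<j j<ℓ → done-before (case ℕₚ.m≤n⇒m<n∨m≡n (proj₂ (own-label i) j i<j j<ℓ) of λ where
          (inj₁ lt) → inj₁ lt
          (inj₂ eq) → inj₂ (sym (toℕ-injective eq) , i<j)))
        x₀ x₀≢a x₀≤i (λ j x₀≤j j<i → done-before (inj₁ (block j x₀≤j j<i))) (λ y i<y _ → small y i<y)
      where
      spine-only : ∀ p → inj₂ p ∉ edges-of is
      spine-only p p∈ with () ← proj₁ (proj₂ (∈-edges⁻ p∈))
      open StepComplete n≢0 w no212 (edges-of is) spine-only

  -- The edges with letter ℓ, and all edges, in the order of labeling.
  occurrences : Fin n → List (Fin n)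
  occurrences ℓ = filter (λ i → ℓ ≟ lookup w i) (reverse (allFin n))

  order : List (Fin n)
  order = concatMap occurrences (reverse (allFin n))

  occurrence : ∀ {ℓ i} → i ∈ occurrences ℓ → ℓ ≡ lookup w i
  occurrence {ℓ} i∈ = proj₂ (∈-filter⁻ (λ i → ℓ ≟ lookup w i) {xs = reverse (allFin n)} i∈)

  order-sorted : AllPairs _≺_ order
  order-sorted = AllPairs-concatMap occurrences (descending n) within
    (λ ℓ>ℓ′ u∈ v∈ → inj₁ (subst₂ Fin._<_ (occurrence v∈) (occurrence u∈) ℓ>ℓ′))
    where
    within : ∀ ℓ → AllPairs _≺_ (occurrences ℓ)
    within ℓ = strengthen (All.tabulate occurrence) (AllPairsₚ.filter⁺ (λ i → ℓ ≟ lookup w i) (descending n))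
      where
      strengthen : ∀ {is} → All (λ i → ℓ ≡ lookup w i) is → AllPairs Fin._>_ is → AllPairs _≺_ is
      strengthen []         []            = []
      strengthen (eq ∷ eqs) (i> ∷ is!) =
        All.zipWith (λ (eq′ , i>j) → inj₂ (trans (sym eq) eq′ , i>j)) (eqs , i>) ∷ strengthen eqs is!

  ∈-order : ∀ i → i ∈ order
  ∈-order i = ∈-concatMap⁺ occurrences (lose (Anyₚ.reverse⁺ (∈-allFin (lookup w i)))
    (∈-filter⁺ (λ j → lookup w i ≟ lookup w j) (Anyₚ.reverse⁺ (∈-allFin i)) refl))

  order-letters : map (lookup w) order ≡ schedule st k
  order-letters = trans (map-concatMap (lookup w) occurrences (reverse (allFin n)))
    (concatMap-cong (λ ℓ → trans (map-filter-≟ (lookup w) ℓ (reverse (allFin n)))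
                                 (cong (λ m → replicate m ℓ) (multiplicity ℓ)))
      (reverse (allFin n)))
    where
    multiplicity : ∀ ℓ → length (occurrences ℓ) ≡ lookup k ℓ
    multiplicity ℓ = begin
      length (occurrences ℓ)
        ≡⟨ ↭-length (filter-↭ (λ i → ℓ ≟ lookup w i) (↭-reverse (allFin n))) ⟩
      length (filter (λ i → ℓ ≟ lookup w i) (allFin n))
        ≡⟨ filter-tabulate (lookup w) ℓ id ⟩
      Vec.count (ℓ ≟_) (Vec.tabulate (lookup w))
        ≡⟨ cong (Vec.count (ℓ ≟_)) (Vecₚ.tabulate∘lookup w) ⟩
      Vec.count (ℓ ≟_) w
        ≡⟨ content ℓ ⟩
      lookup k ℓ ∎
      where open ≡-Reasoning

  valid : IsValidSlideTree (tree w) k w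
  valid with slides-from [] order order-sorted (λ j → inj₂ (∈-order j)) (λ ())
  ... | λs , slides , ∈λs = (st , λs , subst (λ ls → Slides st ls [] λs) order-letters slides) , record
    { root     = inj₁ zero
    ; end      = inj₁ (fromℕ n)
    ; root-a   = inj₂ zero ,
        inj₁ (refl , cong inj₂ (sym (position-unique {zero} refl)))
    ; root-b   = inj₂ (suc zero) ,
        inj₁ (refl , cong inj₂ (sym (position-unique {suc zero} refl)))
    ; spine    = walk
    ; isPath   = isPath
    ; internal = All.map (λ { (i , refl) → spine-notLeaf n≢0 (inject₁ i) , spine-notLeaf n≢0 (suc i) }) spine
    ; complete = λ { (inj₁ i) _ → complete i z≤n ; (inj₂ p) (_ , ¬leaf) → contradiction (leaf-isLeaf p) ¬leaf }
    ; reads    = reads w λ s i i≡ →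
        subst (λ s → (inj₁ i , lookup w s) ∈ λs) (toℕ-injective (trans i≡ (+-identityʳ _))) (∈λs i)
    }
    where open Ascent (ascend n zero (+-identityʳ n))

------------------------------------------------------------------------
-- A slide labeling gives condition (A)

-- Any slide labeling of the tree of w that spells w.
module Sliding {n} (w : Word n) (st : IsStableTree (tree w)) where
  open IsStableTree st using (leaf; label-bijective)

  leaf-position : ∀ x → ∃ λ p → leaf x ≡ inj₂ p × lookup (leafLabels w) p ≡ just x
  leaf-position x with label-bijective x
  ... | inj₂ p , label≡ , _ = p , refl , label≡

  position : Label n → Fin (suc (suc (suc n)))
  position x = proj₁ (leaf-position x)

  leaf≡ : ∀ x → leaf x ≡ inj₂ (position x)
  leaf≡ x = proj₁ (proj₂ (leaf-position x))

  position-label : ∀ x → lookup (leafLabels w) (position x) ≡ just x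
  position-label x = proj₂ (proj₂ (leaf-position x))

  position-unique : ∀ {p x} → lookup (leafLabels w) p ≡ just x → position x ≡ p
  position-unique {p} {x} eq = inj₂-injective
    (trans (sym (leaf≡ x)) (proj₂ (proj₂ (label-bijective x)) {inj₂ p} eq))

  leaf-a : leaf a ≡ inj₂ zero
  leaf-a = trans (leaf≡ a) (cong inj₂ (position-unique {zero} refl))

  -- The label ℓ of edge i satisfies condition (A), with the labels given so
  -- far in place of the letters of w.
  record Placed (λs : EdgeLabeling st) (i ℓ : Fin n) : Set where
    field
      left-of-leaf : suc (toℕ i) < toℕ (position (num ℓ))
      between      : ∀ j → i Fin.< j → suc (toℕ j) < toℕ (position (num ℓ)) →
                     ∃ λ ℓ′ → ℓ Fin.≤ ℓ′ × (inj₁ j , ℓ′) ∈ λs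

  -- What holds for the labeling λs at each stage, when the letters ls are
  -- still to come.
  record Admissible (ls : List (Fin n)) (λs : EdgeLabeling st) : Set where
    field
      spine-only : ∀ {p x} → (inj₂ p , x) ∉ λs
      functional : ∀ {e x y} → (e , x) ∈ λs → (e , y) ∈ λs → x ≡ y
      above      : ∀ {e x} → (e , x) ∈ λs → All (Fin._≤ x) ls
      placed     : ∀ {i ℓ} → (inj₁ i , ℓ) ∈ λs → Placed λs i ℓ

  -- The edges between the new edge and its leaf are labeled already, by
  -- step-sound, hence with larger or equal letters.
  slides-sound : ∀ {ls λs λs′} → Slides st ls λs λs′ → AllPairs Fin._≥_ ls →
                 Admissible ls λs → Admissible [] λs′
  slides-sound done _ adm = adm
  slides-sound {ℓ ∷ ls} {λs} (next e slide slides) (ℓ≥ ∷ ls!) adm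
    with Contracted.step-sound (map proj₁ λs) spine-only′ path e (leaf≡ (num ℓ)) leaf-a
           isPath e∈path e-internal vℓ-adjacent e-joins
    where
    open SlideStep slide
    spine-only′ : ∀ p → inj₂ p ∉ map proj₁ λs
    spine-only′ p p∈ with ∈-map⁻ proj₁ p∈
    ... | _ , p∈′ , refl = Admissible.spine-only adm p∈′
    e∈path : e ∈ edges path
    e∈path = let pre , _ , eq , _ = first in subst (e ∈_) (sym eq) (∈-++⁺ʳ pre (here refl))
    e-internal = let _ , _ , _ , _ , int = first in int
  slides-sound {ℓ ∷ ls} {λs} (next (.(inj₁ i) , [ i∉ ]) slide slides) (ℓ≥ ∷ ls!) adm
    | i , refl , i<ℓ , between = slides-sound slides ls! record
    { spine-only = λ { (there p∈) → spine-only p∈ }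
    ; functional = λ where
        (here refl) (here refl) → refl
        (here refl) (there e∈)  → ⊥-elim-irr (i∉ (∈-map⁺ proj₁ e∈))
        (there e∈)  (here refl) → ⊥-elim-irr (i∉ (∈-map⁺ proj₁ e∈))
        (there e∈)  (there e∈′) → functional e∈ e∈′
    ; above      = λ where
        (here refl) → ℓ≥
        (there e∈)  → All.tail (above e∈)
    ; placed     = λ where
        (here refl) → record { left-of-leaf = i<ℓ ; between = λ j i<j j<ℓ → earlier (between j i<j j<ℓ) }
        (there e∈)  → record
          { left-of-leaf = Placed.left-of-leaf (placed e∈)
          ; between      = λ j i<j j<ℓ →
              let ℓ′ , ℓ≤ℓ′ , j∈ = Placed.between (placed e∈) j i<j j<ℓ in ℓ′ , ℓ≤ℓ′ , there j∈
          }
    }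
    where
    open Admissible adm
    earlier : ∀ {j} → inj₁ j ∈ map proj₁ λs → ∃ λ ℓ′ → ℓ Fin.≤ ℓ′ × (inj₁ j , ℓ′) ∈ (inj₁ i , ℓ) ∷ λs
    earlier j∈ with ∈-map⁻ proj₁ j∈
    ... | (_ , ℓ′) , j∈′ , refl = ℓ′ , All.head (above j∈′) , there j∈′

  schedule-descending : ∀ k → AllPairs Fin._≥_ (schedule st k)
  schedule-descending k = AllPairs-concatMap _ (descending n) (λ ℓ → constant (lookup k ℓ) ℓ)
    λ {ℓ} {ℓ′} ℓ>ℓ′ u∈ v∈ → subst₂ Fin._≤_ (replicated (lookup k ℓ′) v∈) (replicated (lookup k ℓ) u∈) (<⇒≤ ℓ>ℓ′)
    where
    replicated : ∀ m {x y : Fin n} → y ∈ replicate m x → x ≡ y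
    replicated m {x} y∈ = All.lookup (Allₚ.replicate⁺ {P = x ≡_} m refl) y∈
    constant : ∀ m (x : Fin n) → AllPairs Fin._≥_ (replicate m x)
    constant zero    x = []
    constant (suc m) x = Allₚ.replicate⁺ m ≤-refl ∷ constant m x

  module _ (k : Vec ℕ n) {λs : EdgeLabeling st} (slides : IsSlideLabeling st k λs)
           (word : IsEdgeWord st λs w) where

    admissible : Admissible [] λs
    admissible = slides-sound slides (schedule-descending k)
      record { spine-only = λ () ; functional = λ () ; above = λ () ; placed = λ () }
    open Admissible admissible

    reads-word : ∀ i → (inj₁ i , lookup w i) ∈ λs
    reads-word i = from-root root≡ spine isPath internal reads
      where
      open IsEdgeWord word
      root≡ : root ≡ inj₁ zero
      root≡ with root-a
      ... | inj₁ j , inj₁ (_ , t≡) = case trans t≡ leaf-a of λ ()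
      ... | inj₂ p , inj₁ (refl , t≡) = cong (inj₁ ∘ attach) (inj₂-injective (trans t≡ leaf-a))
      ... | inj₁ j , inj₂ (s≡ , _) = case trans s≡ leaf-a of λ ()
      ... | inj₂ p , inj₂ (s≡ , _) = case trans s≡ leaf-a of λ ()
      from-root : ∀ {r v} → r ≡ inj₁ zero → (π : Walk (caterpillar n) r v) → IsPath π →
                  All (Graph.IsInternal (caterpillar n)) (edges π) →
                  Pointwise (λ e x → (e , x) ∈ λs) (edges π) (toList w) → (inj₁ i , lookup w i) ∈ λs
      from-root refl π π! int reads =
        read-spine zero π π! (λ _ ()) int {λ e x → (e , x) ∈ λs} w reads i i (sym (+-identityʳ _))

    own-labels-after : ∀ i s → lookup (fill (unusedLabels (toList w)) w) s ≡ just (num (lookup w i)) →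
      i Fin.≤ s × (∀ j → i Fin.< j → toℕ j ≤ toℕ s → lookup w i Fin.≤ lookup w j)
    own-labels-after i s fs = s≤s⁻¹ (s<s⁻¹ (subst (suc (toℕ i) <_) position≡ left-of-leaf)) , λ j i<j j≤s →
      let ℓ′ , wi≤ℓ′ , j∈ = between j i<j (subst (suc (toℕ j) <_) (sym position≡) (s<s (s≤s j≤s)))
      in subst (lookup w i Fin.≤_) (functional j∈ (reads-word j)) wi≤ℓ′
      where
      open Placed (placed (reads-word i))
      position≡ : toℕ (position (num (lookup w i))) ≡ suc (suc (toℕ s))
      position≡ = cong toℕ (position-unique {suc (suc s)} fs)

    labelled : ∀ i → ∃ λ s → lookup (fill (unusedLabels (toList w)) w) s ≡ just (num (lookup w i))
    labelled i =
      let x = num (lookup w i) ; s , _ , fs = fill-position w (position x) (position-label x) in s , fs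

theorem1p3 : (n : ℕ) → n ≥ 1 →
    (k : Vec ℕ n) → IsComposition k → RightJustified k →
    (w : Word n) → HasContent w k →
    IsValidSlideTree (tree w) k w ⇔ (Avoids-2-1-2 w × Avoids-23-2̅-1 w)
theorem1p3 n n≥1 k _ justified w content = mk⇔ to from
  where
  to : IsValidSlideTree (tree w) k w → Avoids-2-1-2 w × Avoids-23-2̅-1 w
  to ((st , λs , slides) , word) =
    after⇒no212 w k justified content labelled after , after⇒no23 w k justified content labelled after
    where
    labelled = Sliding.labelled w st k slides word
    after = Sliding.own-labels-after w st k slides word
  from : Avoids-2-1-2 w × Avoids-23-2̅-1 w → IsValidSlideTree (tree w) k w
  from (no212 , no23) = Avoiding.valid (λ { refl → case n≥1 of λ () }) w k justified content no212 no23
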